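{- For a nonnegative integer $n$, let $p_{9,3}(n)$ be defined by $\sum_{n\geq0}p_{9,3}(n)q^n=\frac{1}{(q;q)_\infty^3(q^9;q^9)_\infty^3}$. Then for all integers $n\geq0$ and $\alpha\geq1$, \begin{align*} p_{9,3}\left(3^{2\alpha-1}n+\tfrac{3^{2\alpha-1}+5}{4}\right) &\equiv0\pmod{3^{2\alpha}},\\ p_{9,3}\left(3^{2\alpha+1}n+\tfrac{7\cdot3^{2\alpha}+5}{4}\right) &\equiv0\pmod{3^{2\alpha+4}},\\ p_{9,3}\left(3^{2\alpha+1}n+\tfrac{11\cdot3^{2\alpha}+5}{4}\right) &\equiv0\pmod{3^{2\alpha+5}},\\ p_{9,3}\left(3^{2\alpha}n+\tfrac{5\cdot3^{2\alpha-1}+5}{4}\right) &\equiv0\pmod{3^{2\alpha+1}},\\ p_{9,3}\left(3^{2\alpha}n+\tfrac{3^{2\alpha+1}+5}{4}\right) &\equiv0\pmod{3^{2\alpha+2}}. \end{align*}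
   Context: $(a;q)_\infty=\prod_{n\ge0}(1-aq^n)$. $p_{9,3}(n)$ counts 2-color partition triples of $n$ where one of the colors appears only in parts that are multiples of $9$. -}

module Defs where

open import Data.Nat using (ℕ; zero; suc; _+_; _*_; _∸_)
open import Data.Nat.Divisibility using (_∣?_)
open import Relation.Nullary.Decidable using (does)
open import Data.Bool using (if_then_else_)

Series : Set
Series = ℕ → ℕ

sumTo : ℕ → (ℕ → ℕ) → ℕ
sumTo zero    f = f 0
sumTo (suc n) f = sumTo n f + f (suc n)

_⊛_ : Series → Series → Series
(f ⊛ g) n = sumTo n (λ i → f i * g (n ∸ i))

one : Series
one zero    = 1
one (suc _) = 0

-- 1/(1 - q^k) = Σ_{j≥0} q^{k j}  (for k ≥ 1)
geom : ℕ → Series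
geom k n = if does (k ∣? n) then 1 else 0

factor : ℕ → Series
factor k = geom k ⊛ (geom k ⊛ (geom k ⊛ (geom (9 * k) ⊛ (geom (9 * k) ⊛ geom (9 * k)))))

partialProd : ℕ → Series
partialProd zero    = one
partialProd (suc N) = partialProd N ⊛ factor (suc N)

-- p_{9,3}(n) = [q^n] 1/((q;q)_∞^3 (q^9;q^9)_∞^3).
-- Factors with k > n are ≡ 1 mod q^{n+1}, so the coefficient of q^n of the
-- infinite product equals that of the partial product up to k = n.
p93 : ℕ → ℕ
p93 n = partialProd n n

{-# OPTIONS --safe #-}

-- Write φ = (q;q)_∞. Jacobi's formula φ³ = Σ (−1)^k (2k+1) q^(k(k+1)/2) gives the 3-dissection
-- φ³ = a − s, where a is a series in q³ and s = 3q (q⁹;q⁹)³_∞. Multiplying over q ↦ ζq for the cube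
-- roots of unity ζ gives a³ − s³ = (q³;q³)¹²_∞ / (q⁹;q⁹)³_∞, so 1/φ³ = (a² + as + s²) / (a³ − s³).
-- Hence selecting the exponents ≡ r mod 3 in a homogeneous form in a, s over powers of a³ − s³ keeps
-- the monomials with s^e, e ≡ r, each divisible by 3^r. When the degree is a multiple of 3 after
-- removing s^r, only a³ and s³ remain, and these are expressed through q³ ↦ q in
-- T = 27 q (q³;q³)¹²_∞ / φ¹². With X = (q³;q³)⁶_∞ / φ¹² and Y = (q³;q³)¹²_∞ / φ¹⁸ it follows that
-- the section at 3n + 2 of X ℤ[T] lies in 9 Y ℤ[T] and the section at 3n of Y ℤ[T] in X ℤ[T].
-- The section at 3n + 2 of Σ p_{9,3}(n) qⁿ is 9 X, so every two steps gain a factor 9; the other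
-- congruences come from the remaining sections of X ℤ[T] and Y ℤ[T].
module Submission where

-- The product over ζ needs no root of unity: it is the norm form of x³ = q evaluated at the three
-- sections, and its multiplicativity is a polynomial identity over ℤ. No formula for the
-- coefficients of a is ever used; only the value of a³ - s³ matters. Since `T` is not a series in
-- q³, it cannot simply be pulled out of a section. The way round is that `T` is itself nine times a
-- form of degree 0, namely 9 s (a² + as + s²)⁴ / (a³ - s³)³; hence φ⁻³ⁿ times a polynomial in `T`
-- is again a form, of degree -n. The pair `X`, `Y` is matched to the degrees: the section at
-- residue r of a form of degree -d comes back to ℤ[T], up to a fixed factor, when d + r = 6. This
-- happens for φ⁻¹² with r = 2 and for φ⁻¹⁸ with r = 0. For the sections of `Y` ℤ[T] at 3n + 1 and
-- 3n + 2 the general bound 3^r is one factor 3 too small. The missing factor sits in the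
-- coefficients 6 and 21 of (a² + as + s²)⁶, while every multiple of `T` brings 9 · 3^r by the
-- formula above.

-- Cauchy products of integer sequences.

module Convolution where

  open import Data.Nat.Base using (ℕ; zero; suc; _≤_; z≤n; s≤s)
  import Data.Nat.Properties as ℕ
  open import Data.Integer.Base using (ℤ; _+_; _*_; 0ℤ)
  open import Data.Integer.Properties
  open import Data.Integer.Solver using (module +-*-Solver)
  open import Relation.Binary.PropositionalEquality
  open +-*-Solver
  open ≡-Reasoning

  tail : (ℕ → ℤ) → ℕ → ℤ
  tail f n = f (suc n)

  infixl 7 _⋆_
  -- Peeling off the head of the left factor makes the product structurally recursive, so the ring
  -- laws below are inductions on n without any sums over index ranges.
  _⋆_ : (ℕ → ℤ) → (ℕ → ℤ) → ℕ → ℤ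
  (f ⋆ g) zero    = f 0 * g 0
  (f ⋆ g) (suc n) = f 0 * g (suc n) + (tail f ⋆ g) n

  δ₀ : ℤ → ℕ → ℤ
  δ₀ c zero    = c
  δ₀ c (suc _) = 0ℤ

  ⋆-cong≤ : ∀ {f f′ g g′} n → (∀ i → i ≤ n → f i ≡ f′ i) → (∀ i → i ≤ n → g i ≡ g′ i) →
            (f ⋆ g) n ≡ (f′ ⋆ g′) n
  ⋆-cong≤ zero    p r = cong₂ _*_ (p 0 z≤n) (r 0 z≤n)
  ⋆-cong≤ (suc n) p r =
    cong₂ _+_ (cong₂ _*_ (p 0 z≤n) (r (suc n) ℕ.≤-refl))
              (⋆-cong≤ n (λ i i≤n → p (suc i) (s≤s i≤n)) (λ i i≤n → r i (ℕ.m≤n⇒m≤1+n i≤n)))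
    where open import Data.Nat.Properties using (m≤n⇒m≤1+n)

  ⋆-cong : ∀ {f f′ g g′} → (∀ i → f i ≡ f′ i) → (∀ i → g i ≡ g′ i) → ∀ n → (f ⋆ g) n ≡ (f′ ⋆ g′) n
  ⋆-cong p r n = ⋆-cong≤ n (λ i _ → p i) (λ i _ → r i)

  ⋆-sucʳ : ∀ f g n → (f ⋆ g) (suc n) ≡ (f ⋆ tail g) n + f (suc n) * g 0
  ⋆-sucʳ f g zero    = refl
  ⋆-sucʳ f g (suc n) = begin
    f 0 * g (suc (suc n)) + (tail f ⋆ g) (suc n)
      ≡⟨ cong (λ z → f 0 * g (suc (suc n)) + z) (⋆-sucʳ (tail f) g n) ⟩
    f 0 * g (suc (suc n)) + ((tail f ⋆ tail g) n + f (suc (suc n)) * g 0)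
      ≡⟨ +-assoc (f 0 * g (suc (suc n))) ((tail f ⋆ tail g) n) _ ⟨
    f 0 * g (suc (suc n)) + (tail f ⋆ tail g) n + f (suc (suc n)) * g 0 ∎

  ⋆-comm : ∀ f g n → (f ⋆ g) n ≡ (g ⋆ f) n
  ⋆-comm f g zero    = *-comm (f 0) (g 0)
  ⋆-comm f g (suc n) = begin
    f 0 * g (suc n) + (tail f ⋆ g) n  ≡⟨ +-comm (f 0 * g (suc n)) _ ⟩
    (tail f ⋆ g) n + f 0 * g (suc n)  ≡⟨ cong₂ _+_ (⋆-comm (tail f) g n) (*-comm (f 0) _) ⟩
    (g ⋆ tail f) n + g (suc n) * f 0  ≡⟨ ⋆-sucʳ g f n ⟨
    (g ⋆ f) (suc n)                   ∎

  ⋆-distribʳ : ∀ h f g n → ((λ i → f i + g i) ⋆ h) n ≡ (f ⋆ h) n + (g ⋆ h) n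
  ⋆-distribʳ h f g zero    = *-distribʳ-+ (h 0) (f 0) (g 0)
  ⋆-distribʳ h f g (suc n) = begin
    (f 0 + g 0) * h (suc n) + ((λ i → f (suc i) + g (suc i)) ⋆ h) n
      ≡⟨ cong (λ z → (f 0 + g 0) * h (suc n) + z) (⋆-distribʳ h (tail f) (tail g) n) ⟩
    (f 0 + g 0) * h (suc n) + ((tail f ⋆ h) n + (tail g ⋆ h) n)
      ≡⟨ solve 5 (λ a b c x y → (a :+ b) :* c :+ (x :+ y) := (a :* c :+ x) :+ (b :* c :+ y))
           refl (f 0) (g 0) (h (suc n)) ((tail f ⋆ h) n) ((tail g ⋆ h) n) ⟩
    (f ⋆ h) (suc n) + (g ⋆ h) (suc n) ∎

  ⋆-scaleˡ : ∀ c f g n → ((λ i → c * f i) ⋆ g) n ≡ c * (f ⋆ g) n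
  ⋆-scaleˡ c f g zero    = *-assoc c (f 0) (g 0)
  ⋆-scaleˡ c f g (suc n) = begin
    c * f 0 * g (suc n) + ((λ i → c * f (suc i)) ⋆ g) n
      ≡⟨ cong (λ z → c * f 0 * g (suc n) + z) (⋆-scaleˡ c (tail f) g n) ⟩
    c * f 0 * g (suc n) + c * (tail f ⋆ g) n
      ≡⟨ solve 4 (λ a b d x → a :* b :* d :+ a :* x := a :* (b :* d :+ x))
           refl c (f 0) (g (suc n)) ((tail f ⋆ g) n) ⟩
    c * (f ⋆ g) (suc n) ∎

  ⋆-assoc : ∀ f g h n → ((f ⋆ g) ⋆ h) n ≡ (f ⋆ (g ⋆ h)) n
  ⋆-assoc f g h zero    = *-assoc (f 0) (g 0) (h 0)
  ⋆-assoc f g h (suc n) = begin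
    f 0 * g 0 * h (suc n) + (tail (f ⋆ g) ⋆ h) n
      ≡⟨ cong (λ z → f 0 * g 0 * h (suc n) + z)
           (trans (⋆-distribʳ h (λ i → f 0 * g (suc i)) (tail f ⋆ g) n)
                  (cong₂ _+_ (⋆-scaleˡ (f 0) (tail g) h n) (⋆-assoc (tail f) g h n))) ⟩
    f 0 * g 0 * h (suc n) + (f 0 * (tail g ⋆ h) n + (tail f ⋆ (g ⋆ h)) n)
      ≡⟨ solve 5 (λ a b c x y → a :* b :* c :+ (a :* x :+ y) := a :* (b :* c :+ x) :+ y)
           refl (f 0) (g 0) (h (suc n)) ((tail g ⋆ h) n) ((tail f ⋆ (g ⋆ h)) n) ⟩
    (f ⋆ (g ⋆ h)) (suc n) ∎

  0⋆ : ∀ g n → ((λ _ → 0ℤ) ⋆ g) n ≡ 0ℤ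
  0⋆ g zero    = *-zeroˡ (g 0)
  0⋆ g (suc n) = cong₂ _+_ (*-zeroˡ (g (suc n))) (0⋆ g n)

  δ₀⋆ : ∀ c g n → (δ₀ c ⋆ g) n ≡ c * g n
  δ₀⋆ c g zero    = refl
  δ₀⋆ c g (suc n) = trans (cong (λ z → c * g (suc n) + z) (0⋆ g n)) (+-identityʳ (c * g (suc n)))

-- The commutative ring of integer power series, and congruence modulo powers of q.

module PowerSeries where

  open import Algebra.Bundles using (CommutativeRing)
  open import Algebra.Structures using (IsCommutativeRing)
  open import Algebra.Solver.Ring.AlmostCommutativeRing
    using (fromCommutativeRing; _-Raw-AlmostCommutative⟶_)
  import Algebra.Solver.Ring as RingSolver
  open import Data.Integer.Base as ℤ using (ℤ; +_; 0ℤ; 1ℤ)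
  import Data.Integer.Properties as ℤ
  open import Data.Maybe.Base using (just; nothing)
  open import Data.Nat.Base as ℕ using (ℕ; zero; suc; _≤_; s≤s)
  import Data.Nat.Properties as ℕ
  open import Data.Product using (_,_)
  open import Level using (0ℓ)
  open import Relation.Binary.Bundles using (Setoid)
  open import Relation.Binary.Definitions using (WeaklyDecidable)
  open import Relation.Binary.PropositionalEquality as ≡ using (_≡_)
  open import Relation.Nullary.Decidable using (yes; no)
  open Convolution

  -- A record rather than a bare function, with opaque operations below, so that ring expressions
  -- stay symbolic for the solver and are not unfolded into coefficients.
  record ℤ⟦q⟧ : Set where
    constructor series
    field coeff : ℕ → ℤ
  open ℤ⟦q⟧ public

  infix 4 _≈_
  record _≈_ (f g : ℤ⟦q⟧) : Set where
    constructor coeffwise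
    field at : ∀ n → coeff f n ≡ coeff g n
  open _≈_ public

  infix 8 -_
  infixl 7 _*_
  infixl 6 _+_
  opaque
    _+_ _*_ : ℤ⟦q⟧ → ℤ⟦q⟧ → ℤ⟦q⟧
    f + g = series λ n → coeff f n ℤ.+ coeff g n
    f * g = series (coeff f ⋆ coeff g)

    -_ : ℤ⟦q⟧ → ℤ⟦q⟧
    - f = series λ n → ℤ.- coeff f n

    # : ℤ → ℤ⟦q⟧
    # c = series (δ₀ c)

  opaque
    unfolding _+_

    coeff-+ : ∀ f g n → coeff (f + g) n ≡ coeff f n ℤ.+ coeff g n
    coeff-+ f g n = ≡.refl

    coeff-* : ∀ f g n → coeff (f * g) n ≡ (coeff f ⋆ coeff g) n
    coeff-* f g n = ≡.refl

    coeff-# : ∀ c n → coeff (# c) n ≡ δ₀ c n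
    coeff-# c n = ≡.refl

    coeff-#* : ∀ c f n → coeff (# c * f) n ≡ c ℤ.* coeff f n
    coeff-#* c f = δ₀⋆ c (coeff f)

    isCommutativeRing : IsCommutativeRing _≈_ _+_ _*_ -_ (# 0ℤ) (# 1ℤ)
    isCommutativeRing = record
      { isRing = record
        { +-isAbelianGroup = record
          { isGroup = record
            { isMonoid = record
              { isSemigroup = record
                { isMagma = record
                  { isEquivalence = record
                    { refl = coeffwise λ _ → ≡.refl
                    ; sym = λ p → coeffwise λ n → ≡.sym (at p n)
                    ; trans = λ p r → coeffwise λ n → ≡.trans (at p n) (at r n) }
                  ; ∙-cong = λ p r → coeffwise λ n → ≡.cong₂ ℤ._+_ (at p n) (at r n) }
                ; assoc = λ f g h → coeffwise λ n → ℤ.+-assoc (coeff f n) (coeff g n) (coeff h n) }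
              ; identity = (λ f → coeffwise (+-idˡ f))
                         , (λ f → coeffwise λ n → ≡.trans (ℤ.+-comm (coeff f n) _) (+-idˡ f n)) }
            ; inverse = (λ f → coeffwise λ n → ≡.trans (ℤ.+-inverseˡ (coeff f n)) (≡.sym (δ₀-0 n)))
                      , (λ f → coeffwise λ n → ≡.trans (ℤ.+-inverseʳ (coeff f n)) (≡.sym (δ₀-0 n)))
            ; ⁻¹-cong = λ p → coeffwise λ n → ≡.cong ℤ.-_ (at p n) }
          ; comm = λ f g → coeffwise λ n → ℤ.+-comm (coeff f n) (coeff g n) }
        ; *-cong = λ p r → coeffwise (⋆-cong (at p) (at r))
        ; *-assoc = λ f g h → coeffwise (⋆-assoc (coeff f) (coeff g) (coeff h))
        ; *-identity = (λ f → coeffwise (*-idˡ f))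
                     , (λ f → coeffwise λ n → ≡.trans (⋆-comm (coeff f) _ n) (*-idˡ f n))
        ; distrib = (λ f g h → coeffwise λ n →
                      ≡.trans (⋆-comm (coeff f) _ n)
                        (≡.trans (⋆-distribʳ (coeff f) (coeff g) (coeff h) n)
                          (≡.cong₂ ℤ._+_ (⋆-comm (coeff g) _ n) (⋆-comm (coeff h) _ n))))
                  , (λ f g h → coeffwise (⋆-distribʳ (coeff f) (coeff g) (coeff h))) }
      ; *-comm = λ f g → coeffwise (⋆-comm (coeff f) (coeff g)) }
      where
      δ₀-0 : ∀ n → δ₀ 0ℤ n ≡ 0ℤ
      δ₀-0 zero    = ≡.refl
      δ₀-0 (suc n) = ≡.refl
      +-idˡ : ∀ f n → δ₀ 0ℤ n ℤ.+ coeff f n ≡ coeff f n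
      +-idˡ f n = ≡.trans (≡.cong (ℤ._+ coeff f n) (δ₀-0 n)) (ℤ.+-identityˡ (coeff f n))
      *-idˡ : ∀ f n → (δ₀ 1ℤ ⋆ coeff f) n ≡ coeff f n
      *-idˡ f n = ≡.trans (δ₀⋆ 1ℤ (coeff f) n) (ℤ.*-identityˡ (coeff f n))

    #-+ : ∀ a b → # (a ℤ.+ b) ≈ # a + # b
    #-+ a b = coeffwise λ { zero → ≡.refl ; (suc _) → ≡.refl }

    #-* : ∀ a b → # (a ℤ.* b) ≈ # a * # b
    #-* a b = coeffwise λ
      { zero → ≡.refl
      ; (suc n) → ≡.sym (≡.trans (δ₀⋆ a (δ₀ b) (suc n)) (ℤ.*-zeroʳ a)) }

    #-neg : ∀ a → # (ℤ.- a) ≈ - # a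
    #-neg a = coeffwise λ { zero → ≡.refl ; (suc _) → ≡.refl }

  ring : CommutativeRing 0ℓ 0ℓ
  ring = record { isCommutativeRing = isCommutativeRing }

  open CommutativeRing ring public
    using (refl; sym; trans; reflexive; setoid; +-cong; +-congˡ; +-congʳ; *-cong; *-congˡ; *-congʳ;
           -‿cong; *-assoc; *-comm; *-identityˡ; *-identityʳ; zeroˡ; zeroʳ; +-identityˡ; +-identityʳ)
  open import Algebra.Properties.CommutativeSemiring.Exp (CommutativeRing.commutativeSemiring ring) public
    using (_^_; ^-congˡ; ^-homo-*; ^-assocʳ; ^-distrib-*)

  private
    #-morphism : CommutativeRing.rawRing ℤ.+-*-commutativeRing -Raw-AlmostCommutative⟶ fromCommutativeRing ring
    #-morphism = record
      { ⟦_⟧ = # ; +-homo = #-+ ; *-homo = #-* ; -‿homo = #-neg ; 0-homo = refl ; 1-homo = refl }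

    #-≟ : WeaklyDecidable (λ a b → # a ≈ # b)
    #-≟ a b with a ℤ.≟ b
    ... | yes a≡b = just (reflexive (≡.cong # a≡b))
    ... | no  _   = nothing

  open RingSolver (CommutativeRing.rawRing ℤ.+-*-commutativeRing) (fromCommutativeRing ring) #-morphism #-≟ public
    using (solve; _:=_; _:+_; _:*_; _:-_; :-_; _:^_; con)

  open CommutativeRing ring public using (_-_)

  infix 4 _≈_upto_
  -- Congruence modulo q^(n+1). It takes the place of limits: an identity of infinite products is
  -- proved for every n from finite products.
  record _≈_upto_ (f g : ℤ⟦q⟧) (n : ℕ) : Set where
    constructor coeffwise≤
    field at≤ : ∀ i → i ≤ n → coeff f i ≡ coeff g i
  open _≈_upto_ public

  upto-setoid : ℕ → Setoid 0ℓ 0ℓ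
  upto-setoid n = record
    { _≈_ = _≈_upto n
    ; isEquivalence = record
      { refl  = coeffwise≤ λ _ _ → ≡.refl
      ; sym   = λ p → coeffwise≤ λ i i≤n → ≡.sym (at≤ p i i≤n)
      ; trans = λ p r → coeffwise≤ λ i i≤n → ≡.trans (at≤ p i i≤n) (at≤ r i i≤n) } }

  ≈⇒upto : ∀ {f g n} → f ≈ g → f ≈ g upto n
  ≈⇒upto p = coeffwise≤ λ i _ → at p i

  upto-weaken : ∀ {f g m n} → m ≤ n → f ≈ g upto n → f ≈ g upto m
  upto-weaken m≤n p = coeffwise≤ λ i i≤m → at≤ p i (ℕ.≤-trans i≤m m≤n)

  upto⇒≈ : ∀ {f g} → (∀ n → f ≈ g upto n) → f ≈ g
  upto⇒≈ p = coeffwise λ n → at≤ (p n) n ℕ.≤-refl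

  module _ {n : ℕ} where
    open Setoid (upto-setoid n) public using () renaming (refl to ≤refl; sym to ≤sym; trans to ≤trans)

  opaque
    unfolding _+_

    +-cong≤ : ∀ {f f′ g g′ n} → f ≈ f′ upto n → g ≈ g′ upto n → f + g ≈ f′ + g′ upto n
    +-cong≤ p r = coeffwise≤ λ i i≤n → ≡.cong₂ ℤ._+_ (at≤ p i i≤n) (at≤ r i i≤n)

    *-cong≤ : ∀ {f f′ g g′ n} → f ≈ f′ upto n → g ≈ g′ upto n → f * g ≈ f′ * g′ upto n
    *-cong≤ p r = coeffwise≤ λ i i≤n →
      ⋆-cong≤ i (λ j j≤i → at≤ p j (ℕ.≤-trans j≤i i≤n)) (λ j j≤i → at≤ r j (ℕ.≤-trans j≤i i≤n))

    -‿cong≤ : ∀ {f f′ n} → f ≈ f′ upto n → - f ≈ - f′ upto n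
    -‿cong≤ p = coeffwise≤ λ i i≤n → ≡.cong ℤ.-_ (at≤ p i i≤n)

  ^-cong≤ : ∀ {f g n} k → f ≈ g upto n → f ^ k ≈ g ^ k upto n
  ^-cong≤ zero    p = ≤refl
  ^-cong≤ (suc k) p = *-cong≤ p (^-cong≤ k p)

  q : ℤ⟦q⟧
  q = series λ { 1 → 1ℤ ; _ → 0ℤ }

  opaque
    unfolding _+_

    coeff-q*-zero : ∀ f → coeff (q * f) 0 ≡ 0ℤ
    coeff-q*-zero f = ℤ.*-zeroˡ (coeff f 0)

    coeff-q*-suc : ∀ f n → coeff (q * f) (suc n) ≡ coeff f n
    coeff-q*-suc f n = ≡.trans (≡.cong₂ ℤ._+_ (ℤ.*-zeroˡ (coeff f (suc n))) (lemma n)) (ℤ.+-identityˡ (coeff f n))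
      where
      lemma : ∀ n → (tail (coeff q) ⋆ coeff f) n ≡ coeff f n
      lemma zero    = ℤ.*-identityˡ (coeff f 0)
      lemma (suc n) = ≡.trans (≡.cong₂ ℤ._+_ (ℤ.*-identityˡ (coeff f (suc n))) (0⋆ (coeff f) n)) (ℤ.+-identityʳ (coeff f (suc n)))

  q*-cong≤ : ∀ {f g n} → f ≈ g upto n → q * f ≈ q * g upto suc n
  q*-cong≤ {f} {g} p = coeffwise≤ λ
    { zero    _         → ≡.trans (coeff-q*-zero f) (≡.sym (coeff-q*-zero g))
    ; (suc i) (s≤s i≤n) → ≡.trans (coeff-q*-suc f i) (≡.trans (at≤ p i i≤n) (≡.sym (coeff-q*-suc g i))) }

  q^*-cong≤ : ∀ {f g n} k → f ≈ g upto n → q ^ k * f ≈ q ^ k * g upto (k ℕ.+ n)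
  q^*-cong≤ zero    p = *-cong≤ ≤refl p
  q^*-cong≤ {f} {g} (suc k) p =
    ≤trans (≈⇒upto (*-assoc q (q ^ k) f))
      (≤trans (q*-cong≤ (q^*-cong≤ k p)) (≈⇒upto (sym (*-assoc q (q ^ k) g))))

  q^≈0 : ∀ {n} k → n ℕ.< k → q ^ k ≈ # 0ℤ upto n
  q^≈0 zero ()
  q^≈0 {zero}  (suc k) _ = coeffwise≤ λ { zero _ → ≡.trans (coeff-q*-zero (q ^ k)) (≡.sym (coeff-# 0ℤ 0)) }
  q^≈0 {suc n} (suc k) (s≤s n<k) = ≤trans (q*-cong≤ (q^≈0 k n<k)) (≈⇒upto (zeroʳ q))

-- The 3-dissection operators `V` and `U r`.

module Dissection where

  open import Data.Integer.Base as ℤ using (ℤ; +_; 0ℤ; 1ℤ)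
  import Data.Integer.Properties as ℤ
  open import Data.Nat.Base as ℕ using (ℕ; zero; suc; _≤_; z≤n; s≤s)
  import Data.Nat.Properties as ℕ
  open import Data.Nat.DivMod using (DivMod; result; _divMod_)
  open import Data.Fin.Base using (zero; suc)
  open import Data.Product using (_×_; _,_)
  open import Relation.Binary.PropositionalEquality as ≡ using (_≡_; _≢_)
  import Relation.Binary.Reasoning.Setoid as ≈-Reasoning
  open import Relation.Nullary.Negation using (contradiction)
  open Convolution
  open PowerSeries

  -- Recursion in steps of three keeps pace with the head-and-tail recursion of `_⋆_`, so that
  -- compatibility with products needs no division with remainder.
  dilate : (ℕ → ℤ) → ℕ → ℤ
  dilate f zero                = f 0
  dilate f (suc zero)          = 0ℤ
  dilate f (suc (suc zero))    = 0ℤ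
  dilate f (suc (suc (suc n))) = dilate (tail f) n

  -- V f = f(q³), and U r f is the series of the coefficients of f at 3n + r.
  V : ℤ⟦q⟧ → ℤ⟦q⟧
  V f = series (dilate (coeff f))

  U : ℕ → ℤ⟦q⟧ → ℤ⟦q⟧
  U r f = series λ n → coeff f (r ℕ.+ n ℕ.* 3)

  dilate-cong : ∀ {f g} n → (∀ i → i ≤ n → f i ≡ g i) → dilate f n ≡ dilate g n
  dilate-cong zero                p = p 0 z≤n
  dilate-cong (suc zero)          p = ≡.refl
  dilate-cong (suc (suc zero))    p = ≡.refl
  dilate-cong (suc (suc (suc n))) p = dilate-cong n λ i i≤n → p (suc i) (s≤s (ℕ.m≤n⇒m≤1+n (ℕ.m≤n⇒m≤1+n i≤n)))

  dilate-+ : ∀ f g n → dilate (λ i → f i ℤ.+ g i) n ≡ dilate f n ℤ.+ dilate g n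
  dilate-+ f g zero                = ≡.refl
  dilate-+ f g (suc zero)          = ≡.refl
  dilate-+ f g (suc (suc zero))    = ≡.refl
  dilate-+ f g (suc (suc (suc n))) = dilate-+ (tail f) (tail g) n

  dilate-neg : ∀ f n → dilate (λ i → ℤ.- f i) n ≡ ℤ.- dilate f n
  dilate-neg f zero                = ≡.refl
  dilate-neg f (suc zero)          = ≡.refl
  dilate-neg f (suc (suc zero))    = ≡.refl
  dilate-neg f (suc (suc (suc n))) = dilate-neg (tail f) n

  dilate-scale : ∀ c f n → dilate (λ i → c ℤ.* f i) n ≡ c ℤ.* dilate f n
  dilate-scale c f zero                = ≡.refl
  dilate-scale c f (suc zero)          = ≡.sym (ℤ.*-zeroʳ c)
  dilate-scale c f (suc (suc zero))    = ≡.sym (ℤ.*-zeroʳ c)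
  dilate-scale c f (suc (suc (suc n))) = dilate-scale c (tail f) n

  dilate-0 : ∀ n → dilate (λ _ → 0ℤ) n ≡ 0ℤ
  dilate-0 zero                = ≡.refl
  dilate-0 (suc zero)          = ≡.refl
  dilate-0 (suc (suc zero))    = ≡.refl
  dilate-0 (suc (suc (suc n))) = dilate-0 n

  dilate-⋆-step : ∀ f g n →
    (dilate f ⋆ g) (3 ℕ.+ n) ≡ f 0 ℤ.* g (3 ℕ.+ n) ℤ.+ (dilate (tail f) ⋆ g) n
  dilate-⋆-step f g n = ≡.cong (λ z → f 0 ℤ.* g (3 ℕ.+ n) ℤ.+ z)
    (≡.trans (drop (g (2 ℕ.+ n)) _) (drop (g (1 ℕ.+ n)) _))
    where
    drop : ∀ z x → 0ℤ ℤ.* z ℤ.+ x ≡ x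
    drop z x = ≡.trans (≡.cong (ℤ._+ x) (ℤ.*-zeroˡ z)) (ℤ.+-identityˡ x)

  dilate-⋆ : ∀ f g n → dilate (f ⋆ g) n ≡ (dilate f ⋆ dilate g) n
  dilate-⋆ f g zero                = ≡.refl
  dilate-⋆ f g (suc zero)          = ≡.sym (≡.cong₂ ℤ._+_ (ℤ.*-zeroʳ (f 0)) (ℤ.*-zeroˡ (g 0)))
  dilate-⋆ f g (suc (suc zero))    = ≡.sym (≡.cong₂ ℤ._+_ (ℤ.*-zeroʳ (f 0)) (≡.cong₂ ℤ._+_ (ℤ.*-zeroˡ 0ℤ) (ℤ.*-zeroˡ (g 0))))
  dilate-⋆ f g (suc (suc (suc n))) = ≡.trans
    (dilate-+ (λ i → f 0 ℤ.* g (suc i)) (tail f ⋆ g) n)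
    (≡.trans (≡.cong₂ ℤ._+_ (dilate-scale (f 0) (tail g) n) (dilate-⋆ (tail f) g n))
      (≡.sym (dilate-⋆-step f (dilate g) n)))

  V-cong≤ : ∀ {f g n} → f ≈ g upto n → V f ≈ V g upto n
  V-cong≤ p = coeffwise≤ λ i i≤n → dilate-cong i λ j j≤i → at≤ p j (ℕ.≤-trans j≤i i≤n)

  V-cong : ∀ {f g} → f ≈ g → V f ≈ V g
  V-cong p = coeffwise λ n → dilate-cong n λ i _ → at p i

  U-cong : ∀ {f g} r → f ≈ g → U r f ≈ U r g
  U-cong r p = coeffwise λ n → at p (r ℕ.+ n ℕ.* 3)

  U-cong≤ : ∀ {f g} r {n} → f ≈ g upto (r ℕ.+ n ℕ.* 3) → U r f ≈ U r g upto n
  U-cong≤ r p = coeffwise≤ λ i i≤n → at≤ p (r ℕ.+ i ℕ.* 3) (ℕ.+-monoʳ-≤ r (ℕ.*-monoˡ-≤ 3 i≤n))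

  dilate-0+ : ∀ f n → dilate f (n ℕ.* 3) ≡ f n
  dilate-0+ f zero    = ≡.refl
  dilate-0+ f (suc n) = dilate-0+ (tail f) n

  dilate-1+ : ∀ f n → dilate f (1 ℕ.+ n ℕ.* 3) ≡ 0ℤ
  dilate-1+ f zero    = ≡.refl
  dilate-1+ f (suc n) = dilate-1+ (tail f) n

  dilate-2+ : ∀ f n → dilate f (2 ℕ.+ n ℕ.* 3) ≡ 0ℤ
  dilate-2+ f zero    = ≡.refl
  dilate-2+ f (suc n) = dilate-2+ (tail f) n

  U0-V : ∀ f → U 0 (V f) ≈ f
  U0-V f = coeffwise (dilate-0+ (coeff f))


  δ₀-0 : ∀ n → δ₀ 0ℤ n ≡ 0ℤ
  δ₀-0 zero    = ≡.refl
  δ₀-0 (suc n) = ≡.refl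

  opaque
    unfolding _+_

    V-+ : ∀ f g → V (f + g) ≈ V f + V g
    V-+ f g = coeffwise (dilate-+ (coeff f) (coeff g))

    V-neg : ∀ f → V (- f) ≈ - V f
    V-neg f = coeffwise (dilate-neg (coeff f))

    V-* : ∀ f g → V (f * g) ≈ V f * V g
    V-* f g = coeffwise (dilate-⋆ (coeff f) (coeff g))

    V-# : ∀ c → V (# c) ≈ # c
    V-# c = coeffwise λ
      { zero → ≡.refl ; (suc zero) → ≡.refl ; (suc (suc zero)) → ≡.refl ; (suc (suc (suc n))) → dilate-0 n }

    U-+ : ∀ r f g → U r (f + g) ≈ U r f + U r g
    U-+ r f g = coeffwise λ _ → ≡.refl

    U1-V : ∀ f → U 1 (V f) ≈ # 0ℤ
    U1-V f = coeffwise λ n → ≡.trans (dilate-1+ (coeff f) n) (≡.sym (δ₀-0 n))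

    U2-V : ∀ f → U 2 (V f) ≈ # 0ℤ
    U2-V f = coeffwise λ n → ≡.trans (dilate-2+ (coeff f) n) (≡.sym (δ₀-0 n))

    private
      U-V*-step : ∀ r g f n → (coeff (U r (series (dilate (tail g) ⋆ f))) n) ≡ (tail g ⋆ coeff (U r (series f))) n →
                  (dilate g ⋆ f) (3 ℕ.+ (r ℕ.+ n ℕ.* 3)) ≡
                  g 0 ℤ.* f (3 ℕ.+ (r ℕ.+ n ℕ.* 3)) ℤ.+ (tail g ⋆ coeff (U r (series f))) n
      U-V*-step r g f n ih = ≡.trans (dilate-⋆-step g f (r ℕ.+ n ℕ.* 3)) (≡.cong (λ z → g 0 ℤ.* f (3 ℕ.+ (r ℕ.+ n ℕ.* 3)) ℤ.+ z) ih)

      U0-V*-coeff : ∀ g f n → (dilate g ⋆ f) (n ℕ.* 3) ≡ (g ⋆ coeff (U 0 (series f))) n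
      U0-V*-coeff g f zero    = ≡.refl
      U0-V*-coeff g f (suc n) = U-V*-step 0 g f n (U0-V*-coeff (tail g) f n)

      U1-V*-coeff : ∀ g f n → (dilate g ⋆ f) (1 ℕ.+ n ℕ.* 3) ≡ (g ⋆ coeff (U 1 (series f))) n
      U1-V*-coeff g f zero    = ≡.trans (≡.cong (λ z → g 0 ℤ.* f 1 ℤ.+ z) (ℤ.*-zeroˡ (f 0))) (ℤ.+-identityʳ (g 0 ℤ.* f 1))
      U1-V*-coeff g f (suc n) = U-V*-step 1 g f n (U1-V*-coeff (tail g) f n)

      U2-V*-coeff : ∀ g f n → (dilate g ⋆ f) (2 ℕ.+ n ℕ.* 3) ≡ (g ⋆ coeff (U 2 (series f))) n
      U2-V*-coeff g f zero    = ≡.trans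
        (≡.cong (λ z → g 0 ℤ.* f 2 ℤ.+ z) (≡.cong₂ ℤ._+_ (ℤ.*-zeroˡ (f 1)) (ℤ.*-zeroˡ (f 0))))
        (ℤ.+-identityʳ (g 0 ℤ.* f 2))
      U2-V*-coeff g f (suc n) = U-V*-step 2 g f n (U2-V*-coeff (tail g) f n)

    -- A series in q³ does not mix residue classes, so such series act as scalars for sections. This
    -- is how powers of `B` and `V M` leave `U r`.
    U-V* : ∀ {r} g f → r ℕ.< 3 → U r (V g * f) ≈ g * U r f
    U-V* {0} g f _ = coeffwise (U0-V*-coeff (coeff g) (coeff f))
    U-V* {1} g f _ = coeffwise (U1-V*-coeff (coeff g) (coeff f))
    U-V* {2} g f _ = coeffwise (U2-V*-coeff (coeff g) (coeff f))
    U-V* {suc (suc (suc r))} g f (s≤s (s≤s (s≤s ())))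

    U-#* : ∀ r c f → U r (# c * f) ≈ # c * U r f
    U-#* r c f = coeffwise λ n →
      ≡.trans (δ₀⋆ c (coeff f) (r ℕ.+ n ℕ.* 3)) (≡.sym (δ₀⋆ c (coeff (U r f)) n))

  U-suc-q* : ∀ r f → U (suc r) (q * f) ≈ U r f
  U-suc-q* r f = coeffwise λ n → coeff-q*-suc f (r ℕ.+ n ℕ.* 3)

  U-0-q* : ∀ f → U 0 (q * f) ≈ q * U 2 f
  U-0-q* f = coeffwise λ
    { zero    → ≡.trans (coeff-q*-zero f) (≡.sym (coeff-q*-zero (U 2 f)))
    ; (suc n) → ≡.trans (coeff-q*-suc f (2 ℕ.+ n ℕ.* 3)) (≡.sym (coeff-q*-suc (U 2 f) n)) }

  V-^ : ∀ f n → V (f ^ n) ≈ V f ^ n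
  V-^ f zero    = V-# 1ℤ
  V-^ f (suc n) = trans (V-* f (f ^ n)) (*-congˡ (V-^ f n))

  sections-≈ : ∀ {f g} → U 0 f ≈ U 0 g → U 1 f ≈ U 1 g → U 2 f ≈ U 2 g → f ≈ g
  sections-≈ {f} {g} p₀ p₁ p₂ = coeffwise λ n → lemma n (n divMod 3)
    where
    lemma : ∀ n → DivMod n 3 → coeff f n ≡ coeff g n
    lemma _ (result m zero             ≡.refl) = at p₀ m
    lemma _ (result m (suc zero)       ≡.refl) = at p₁ m
    lemma _ (result m (suc (suc zero)) ≡.refl) = at p₂ m

  sections : ∀ f₀ f₁ f₂ → let f = V f₀ + q * (V f₁ + q * V f₂) in
             U 0 f ≈ f₀ × U 1 f ≈ f₁ × U 2 f ≈ f₂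
  sections f₀ f₁ f₂ =
      trans (U-+ 0 _ _) (trans (+-cong (U0-V f₀)
        (trans (U-0-q* _) (trans (*-congˡ (trans (U-+ 2 _ _) (+-cong (U2-V f₁) (trans (U-suc-q* 1 _) (U1-V f₂)))))
          (solve 1 (λ x → x :* (con 0ℤ :+ con 0ℤ) := con 0ℤ) refl q))))
        (+-identityʳ f₀))
    , trans (U-+ 1 _ _) (trans (+-cong (U1-V f₀)
        (trans (U-suc-q* 0 _) (trans (U-+ 0 _ _) (+-cong (U0-V f₁)
          (trans (U-0-q* _) (trans (*-congˡ (U2-V f₂)) (zeroʳ q)))))))
        (solve 1 (λ x → con 0ℤ :+ (x :+ con 0ℤ) := x) refl f₁))
    , trans (U-+ 2 _ _) (trans (+-cong (U2-V f₀)
        (trans (U-suc-q* 1 _) (trans (U-+ 1 _ _) (+-cong (U1-V f₁) (trans (U-suc-q* 0 _) (U0-V f₂))))))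
        (solve 1 (λ x → con 0ℤ :+ (con 0ℤ :+ x) := x) refl f₂))

  decompose : ∀ f → f ≈ V (U 0 f) + q * (V (U 1 f) + q * V (U 2 f))
  decompose f with e₀ , e₁ , e₂ ← sections (U 0 f) (U 1 f) (U 2 f) = sections-≈ (sym e₀) (sym e₁) (sym e₂)

  V-q : V q ≈ q ^ 3
  V-q = sections-≈
    (trans (U0-V q) (sym (trans (U-0-q* _) (trans (*-congˡ (trans (U-suc-q* 1 _) (U-suc-q* 0 _))) q*1))))
    (trans (U1-V q) (sym (trans (U-suc-q* 0 _) (trans (U-0-q* _) (trans (*-congˡ (trans (U-suc-q* 1 _) (U-1))) (zeroʳ q))))))
    (trans (U2-V q) (sym (trans (U-suc-q* 1 _) (trans (U-suc-q* 0 _) (trans (U-0-q* _) (trans (*-congˡ U2-1) (zeroʳ q)))))))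
    where
    q*1 : q * U 0 (# 1ℤ) ≈ q
    q*1 = trans (*-congˡ (trans (U-cong 0 (sym (V-# 1ℤ))) (U0-V (# 1ℤ)))) (*-identityʳ q)
    U-1 : U 1 (# 1ℤ) ≈ # 0ℤ
    U-1 = trans (U-cong 1 (sym (V-# 1ℤ))) (U1-V (# 1ℤ))
    U2-1 : U 2 (# 1ℤ) ≈ # 0ℤ
    U2-1 = trans (U-cong 2 (sym (V-# 1ℤ))) (U2-V (# 1ℤ))

  U-q^V-diag : ∀ r f → U r (q ^ r * V f) ≈ f
  U-q^V-diag zero    f = trans (U-cong 0 (*-identityˡ (V f))) (U0-V f)
  U-q^V-diag (suc r) f = trans (U-cong (suc r) (*-assoc q (q ^ r) (V f))) (trans (U-suc-q* r _) (U-q^V-diag r f))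

  U-q^V-off : ∀ {r t} f → r ℕ.< 3 → t ℕ.< 3 → r ≢ t → U r (q ^ t * V f) ≈ # 0ℤ
  U-q^V-off {r} {t} f r<3 t<3 r≢t =
    trans (U-cong r (*-comm (q ^ t) (V f))) (trans (U-V* f (q ^ t) r<3) (trans (*-congˡ (lemma r<3 t<3 r≢t)) (zeroʳ f)))
    where
    V1 : ∀ {r} → U r (V (# 1ℤ)) ≈ # 0ℤ → U r (# 1ℤ) ≈ # 0ℤ
    V1 {r} = trans (U-cong r (sym (V-# 1ℤ)))
    lemma : ∀ {r t} → r ℕ.< 3 → t ℕ.< 3 → r ≢ t → U r (q ^ t) ≈ # 0ℤ
    lemma {0} {0} _ _ 0≢0 = contradiction ≡.refl 0≢0
    lemma {1} {0} _ _ _ = V1 (U1-V (# 1ℤ))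
    lemma {2} {0} _ _ _ = V1 (U2-V (# 1ℤ))
    lemma {0} {1} _ _ _ = trans (U-0-q* _) (trans (*-congˡ (lemma {2} {0} (s≤s (s≤s (s≤s z≤n))) (s≤s z≤n) λ ())) (zeroʳ q))
    lemma {0} {2} _ _ _ = trans (U-0-q* _) (trans (*-congˡ (lemma {2} {1} (s≤s (s≤s (s≤s z≤n))) (s≤s (s≤s z≤n)) λ ())) (zeroʳ q))
    lemma {suc r} {suc t} r<3 t<3 r≢t =
      trans (U-suc-q* r _) (lemma (ℕ.<-trans (ℕ.n<1+n r) r<3) (ℕ.<-trans (ℕ.n<1+n t) t<3) λ r≡t → r≢t (≡.cong suc r≡t))
    lemma {suc (suc (suc r))} {0} (s≤s (s≤s (s≤s ()))) _ _
    lemma {0} {suc (suc (suc t))} _ (s≤s (s≤s (s≤s ()))) _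

  q^*3 : ∀ n → q ^ (n ℕ.* 3) ≈ V (q ^ n)
  q^*3 n = begin
    q ^ (n ℕ.* 3) ≈⟨ reflexive (≡.cong (q ^_) (ℕ.*-comm n 3)) ⟩
    q ^ (3 ℕ.* n) ≈⟨ ^-assocʳ q 3 n ⟨
    (q ^ 3) ^ n   ≈⟨ ^-congˡ n V-q ⟨
    V q ^ n       ≈⟨ V-^ q n ⟨
    V (q ^ n)     ∎
    where open ≈-Reasoning setoid

-- The Euler product and its inverse as stable limits.

module EulerProduct where

  open import Data.Bool.Base using (if_then_else_)
  open import Data.Integer.Base as ℤ using (+_; 0ℤ; 1ℤ)
  import Data.Integer.Properties as ℤ
  open import Data.Nat.Base as ℕ using (ℕ; zero; suc; _≤_; s≤s)
  import Data.Nat.Properties as ℕ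
  open import Data.Nat.Divisibility using (_∣?_; ∣m+n∣m⇒∣n; ∣m∣n⇒∣m+n; ∣-refl; >⇒∤; _∣0)
  open import Data.Product using (_,_)
  open import Function.Bundles using (mk⇔)
  open import Relation.Binary.PropositionalEquality as ≡ using (_≡_)
  open import Relation.Nullary.Decidable using (yes; no; does-⇔; dec-true; dec-false)
  import Relation.Binary.Reasoning.Setoid as ≈-Reasoning
  open import Defs using (geom)
  open PowerSeries
  open Dissection

  -- The diagonal of coefficients; it deserves the name only for sequences whose m-th term already
  -- fixes the coefficients up to m, as in `lim-upto`.
  lim : (ℕ → ℤ⟦q⟧) → ℤ⟦q⟧
  lim F = series λ n → coeff (F n) n

  stable-upto : ∀ {F : ℕ → ℤ⟦q⟧} → (∀ m → F (suc m) ≈ F m upto m) → ∀ {n m} → n ≤ m → F m ≈ F n upto n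
  stable-upto {F} st {n} n≤m = lemma (ℕ.≤⇒≤′ n≤m)
    where
    lemma : ∀ {m} → n ℕ.≤′ m → F m ≈ F n upto n
    lemma (ℕ.≤′-reflexive ≡.refl) = ≤refl
    lemma (ℕ.≤′-step n≤′m) = ≤trans (upto-weaken (ℕ.≤′⇒≤ n≤′m) (st _)) (lemma n≤′m)

  lim-upto : ∀ {F} → (∀ m → F (suc m) ≈ F m upto m) → ∀ {n m} → n ≤ m → lim F ≈ F m upto n
  lim-upto {F} st n≤m = coeffwise≤ λ i i≤n →
    ≡.sym (at≤ (stable-upto {F} st (ℕ.≤-trans i≤n n≤m)) i ℕ.≤-refl)

  poch : ℕ → ℤ⟦q⟧
  poch zero    = # 1ℤ
  poch (suc m) = poch m * (# 1ℤ - q ^ suc m)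

  geometric : ℕ → ℤ⟦q⟧
  geometric k = series λ n → + geom k n

  poch⁻¹ : ℕ → ℤ⟦q⟧
  poch⁻¹ zero    = # 1ℤ
  poch⁻¹ (suc m) = poch⁻¹ m * geometric (suc m)

  coeff-q^* : ∀ k f n → coeff (q ^ k * f) (k ℕ.+ n) ≡ coeff f n
  coeff-q^* zero    f n = at (*-identityˡ f) n
  coeff-q^* (suc k) f n =
    ≡.trans (at (*-assoc q (q ^ k) f) (suc k ℕ.+ n)) (≡.trans (coeff-q*-suc (q ^ k * f) (k ℕ.+ n)) (coeff-q^* k f n))

  geometric≈1 : ∀ k → geometric (suc k) ≈ # 1ℤ upto k
  geometric≈1 k = coeffwise≤ λ
    { zero    _   → ≡.trans (≡.cong (λ b → + (if b then 1 else 0)) (dec-true (suc k ∣? 0) (suc k ∣0)))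
                            (≡.sym (coeff-# 1ℤ 0))
    ; (suc i) i<k → ≡.trans (≡.cong (λ b → + (if b then 1 else 0)) (dec-false (suc k ∣? suc i) (>⇒∤ (s≤s i<k))))
                            (≡.sym (coeff-# 1ℤ (suc i))) }

  geometric-rec : ∀ k → geometric (suc k) ≈ # 1ℤ + q ^ suc k * geometric (suc k)
  geometric-rec k = coeffwise lemma
    where
    g = geometric (suc k)
    low : g ≈ # 1ℤ + q ^ suc k * g upto k
    low = ≤trans (geometric≈1 k) (≤sym
      (≤trans (+-cong≤ ≤refl (≤trans (*-cong≤ (q^≈0 (suc k) ℕ.≤-refl) ≤refl) (≈⇒upto (zeroˡ g))))
        (≈⇒upto (+-identityʳ (# 1ℤ)))))
    high : ∀ d → coeff g (suc k ℕ.+ d) ≡ coeff (# 1ℤ + q ^ suc k * g) (suc k ℕ.+ d)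
    high d = begin
      coeff g (suc k ℕ.+ d)
        ≡⟨ ≡.cong (λ b → + (if b then 1 else 0))
          (does-⇔ (mk⇔ (λ k∣k+d → ∣m+n∣m⇒∣n k∣k+d ∣-refl) (∣m∣n⇒∣m+n ∣-refl))
          (suc k ∣? (suc k ℕ.+ d)) (suc k ∣? d)) ⟩
      coeff g d
        ≡⟨ coeff-q^* (suc k) g d ⟨
      coeff (q ^ suc k * g) (suc k ℕ.+ d)
        ≡⟨ ℤ.+-identityˡ _ ⟨
      0ℤ ℤ.+ coeff (q ^ suc k * g) (suc k ℕ.+ d)
        ≡⟨ ≡.cong (ℤ._+ coeff (q ^ suc k * g) (suc k ℕ.+ d)) (coeff-# 1ℤ (suc k ℕ.+ d)) ⟨
      coeff (# 1ℤ) (suc k ℕ.+ d) ℤ.+ coeff (q ^ suc k * g) (suc k ℕ.+ d)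
        ≡⟨ coeff-+ (# 1ℤ) (q ^ suc k * g) (suc k ℕ.+ d) ⟨
      coeff (# 1ℤ + q ^ suc k * g) (suc k ℕ.+ d) ∎
      where open ≡.≡-Reasoning
    lemma : ∀ n → coeff g n ≡ coeff (# 1ℤ + q ^ suc k * g) n
    lemma n with n ℕ.≤? k
    ... | yes n≤k = at≤ low n n≤k
    ... | no  n≰k with d , ≡.refl ← ℕ.m≤n⇒∃[o]m+o≡n (ℕ.≰⇒> n≰k) = high d

  geometric-inverse : ∀ k → geometric (suc k) * (# 1ℤ - q ^ suc k) ≈ # 1ℤ
  geometric-inverse k = begin
    g * (# 1ℤ - x)       ≈⟨ solve 2 (λ g x → g :* (con 1ℤ :- x) := g :- x :* g) refl g x ⟩
    g - x * g            ≈⟨ +-congʳ (geometric-rec k) ⟩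
    # 1ℤ + x * g - x * g ≈⟨ solve 1 (λ y → con 1ℤ :+ y :- y := con 1ℤ) refl (x * g) ⟩
    # 1ℤ                 ∎
    where
    open ≈-Reasoning setoid
    g = geometric (suc k)
    x = q ^ suc k

  poch⁻¹-inverse : ∀ m → poch⁻¹ m * poch m ≈ # 1ℤ
  poch⁻¹-inverse zero    = *-identityˡ (# 1ℤ)
  poch⁻¹-inverse (suc m) = begin
    poch⁻¹ m * g * (poch m * y)   ≈⟨ solve 4 (λ a b c d → a :* b :* (c :* d) := a :* c :* (b :* d)) refl (poch⁻¹ m) g (poch m) y ⟩
    poch⁻¹ m * poch m * (g * y)   ≈⟨ *-cong (poch⁻¹-inverse m) (geometric-inverse m) ⟩
    # 1ℤ * # 1ℤ                   ≈⟨ *-identityˡ (# 1ℤ) ⟩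
    # 1ℤ                          ∎
    where
    open ≈-Reasoning setoid
    g = geometric (suc m)
    y = # 1ℤ - q ^ suc m

  -- φ = (q;q)_∞
  φ φ⁻¹ : ℤ⟦q⟧
  φ   = lim poch
  φ⁻¹ = lim poch⁻¹

  private
    poch-stable : ∀ m → poch (suc m) ≈ poch m upto m
    poch-stable m = ≤trans (*-cong≤ ≤refl (+-cong≤ ≤refl (-‿cong≤ (q^≈0 (suc m) ℕ.≤-refl))))
      (≈⇒upto (solve 1 (λ p → p :* (con 1ℤ :- con 0ℤ) := p) refl (poch m)))

    poch⁻¹-stable : ∀ m → poch⁻¹ (suc m) ≈ poch⁻¹ m upto m
    poch⁻¹-stable m = ≤trans (*-cong≤ ≤refl (geometric≈1 m)) (≈⇒upto (*-identityʳ (poch⁻¹ m)))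

  φ-upto : ∀ {n m} → n ≤ m → φ ≈ poch m upto n
  φ-upto = lim-upto {poch} poch-stable

  φ⁻¹-upto : ∀ {n m} → n ≤ m → φ⁻¹ ≈ poch⁻¹ m upto n
  φ⁻¹-upto = lim-upto {poch⁻¹} poch⁻¹-stable

  φ⁻¹*φ≈1 : φ⁻¹ * φ ≈ # 1ℤ
  φ⁻¹*φ≈1 = upto⇒≈ λ n →
    ≤trans (*-cong≤ (φ⁻¹-upto (ℕ.≤-refl {n})) (φ-upto ℕ.≤-refl)) (≈⇒upto (poch⁻¹-inverse n))

-- Jacobi's formula from a finite triple product, and the 3-dissection of φ³.

module Jacobi where

  open import Data.Integer.Base as ℤ using (ℤ; +_; 0ℤ; 1ℤ)
  open import Data.Nat.Base as ℕ using (ℕ; zero; suc; _≤_; _<_; z≤n; s≤s)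
  import Data.Nat.Properties as ℕ
  open import Data.Product using (∃-syntax; _×_; _,_; proj₁; proj₂)
  open import Relation.Binary.PropositionalEquality as ≡ using (_≡_)
  import Relation.Binary.Reasoning.Setoid as ≈-Reasoning
  open PowerSeries
  open Dissection
  open EulerProduct

  private
    -3ℤ : ℤ
    -3ℤ = ℤ.- (+ 3)

  -- q^(k(k+1)/2)
  τ : ℕ → ℤ⟦q⟧
  τ zero    = # 1ℤ
  τ (suc k) = q ^ suc k * τ k

  -- W n k = q^(k(k+1)/2) [2n+1 choose n−k]_q; by the symmetry W n (−1 − k) = W n k this is, up to
  -- sign, the coefficient of z^k in (1 − z⁻¹) ∏_{1≤j≤n} (1 − z q^j)(1 − z⁻¹ q^j).
  W : ℕ → ℕ → ℤ⟦q⟧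
  W zero    zero    = # 1ℤ
  W zero    (suc k) = # 0ℤ
  W (suc n) zero    = q ^ suc n * (W n 1 + W n 0) + (# 1ℤ + q ^ suc n * q ^ suc n) * W n 0
  W (suc n) (suc k) = q ^ suc n * (W n (2 ℕ.+ k) + W n k) + (# 1ℤ + q ^ suc n * q ^ suc n) * W n (suc k)

  W-vanish : ∀ {n k} → n < k → W n k ≈ # 0ℤ
  W-vanish {zero}  {suc k} _ = refl
  W-vanish {suc n} {suc k} (s≤s n<k) = begin
    Y * (W n (2 ℕ.+ k) + W n k) + (# 1ℤ + Y * Y) * W n (suc k)
      ≈⟨ +-cong (*-congˡ (+-cong (W-vanish (ℕ.<-trans n<k (ℕ.<-trans (ℕ.n<1+n k) (ℕ.n<1+n (suc k))))) (W-vanish n<k)))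
                (*-congˡ (W-vanish (ℕ.<-trans n<k (ℕ.n<1+n k)))) ⟩
    Y * (# 0ℤ + # 0ℤ) + (# 1ℤ + Y * Y) * # 0ℤ
      ≈⟨ solve 1 (λ y → y :* (con 0ℤ :+ con 0ℤ) :+ (con 1ℤ :+ y :* y) :* con 0ℤ := con 0ℤ) refl Y ⟩
    # 0ℤ ∎
    where
    open ≈-Reasoning setoid
    Y = q ^ suc n

  private
    poch-suc : ∀ m {z} → q ^ m ≈ z → poch (suc m) ≈ poch m * (# 1ℤ - q * z)
    poch-suc m p = *-congˡ (+-congˡ (-‿cong (*-congˡ p)))

    -- The edge case k = 0, with `x` = q^n and `p` = (q;q)_n. The neighbour at -1 is folded onto
    -- `w₀` by the symmetry of `W`, which makes this identity differ from the generic one.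
    W-zero-algebra : ∀ {w₀ w₁ p x P} →
      w₀ * (p * (p * (# 1ℤ - q * x))) ≈ P →
      w₁ * (p * (p * (# 1ℤ - q * x) * (# 1ℤ - q * (q * x)))) ≈ q * (# 1ℤ - x) * P →
      (q * x * (w₁ + w₀) + (# 1ℤ + q * x * (q * x)) * w₀) *
        (p * (# 1ℤ - q * x) * (p * (# 1ℤ - q * x) * (# 1ℤ - q * (q * x))))
      ≈ P * (# 1ℤ - q * (q * (x * x))) * (# 1ℤ - q * (q * (q * (x * x))))
    W-zero-algebra {w₀} {w₁} {p} {x} {P} h₀ h₁ = begin
      (q * x * (w₁ + w₀) + (# 1ℤ + q * x * (q * x)) * w₀) *
        (p * (# 1ℤ - q * x) * (p * (# 1ℤ - q * x) * (# 1ℤ - q * (q * x))))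
        ≈⟨ solve 5 (λ q w₀ w₁ p x →
             (q :* x :* (w₁ :+ w₀) :+ (con 1ℤ :+ q :* x :* (q :* x)) :* w₀) :*
               (p :* (con 1ℤ :- q :* x) :* (p :* (con 1ℤ :- q :* x) :* (con 1ℤ :- q :* (q :* x))))
             := (con 1ℤ :- q :* x) :* (q :* x) :* (w₁ :* (p :* (p :* (con 1ℤ :- q :* x) :* (con 1ℤ :- q :* (q :* x)))))
               :+ (con 1ℤ :- q :* x) :* (con 1ℤ :+ q :* x :+ q :* x :* (q :* x)) :* (con 1ℤ :- q :* (q :* x))
                  :* (w₀ :* (p :* (p :* (con 1ℤ :- q :* x)))))
             refl q w₀ w₁ p x ⟩
      (# 1ℤ - q * x) * (q * x) * (w₁ * (p * (p * (# 1ℤ - q * x) * (# 1ℤ - q * (q * x)))))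
        + (# 1ℤ - q * x) * (# 1ℤ + q * x + q * x * (q * x)) * (# 1ℤ - q * (q * x))
          * (w₀ * (p * (p * (# 1ℤ - q * x))))
        ≈⟨ +-cong (*-congˡ h₁) (*-congˡ h₀) ⟩
      (# 1ℤ - q * x) * (q * x) * (q * (# 1ℤ - x) * P)
        + (# 1ℤ - q * x) * (# 1ℤ + q * x + q * x * (q * x)) * (# 1ℤ - q * (q * x)) * P
        ≈⟨ solve 3 (λ q x P →
             (con 1ℤ :- q :* x) :* (q :* x) :* (q :* (con 1ℤ :- x) :* P)
               :+ (con 1ℤ :- q :* x) :* (con 1ℤ :+ q :* x :+ q :* x :* (q :* x)) :* (con 1ℤ :- q :* (q :* x)) :* P
             := P :* (con 1ℤ :- q :* (q :* (x :* x))) :* (con 1ℤ :- q :* (q :* (q :* (x :* x)))))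
             refl q x P ⟩
      P * (# 1ℤ - q * (q * (x * x))) * (# 1ℤ - q * (q * (q * (x * x)))) ∎
      where open ≈-Reasoning setoid

    -- Here x = q^d and κ = q^k, for n = k + d.
    W-suc-algebra : ∀ {w₀ w₁ w₂ p c t P κ x} →
      let e = q * (q * (κ * (κ * x))) ; y = q * (κ * x) ; f = q * (q * (κ * x * (κ * x))) in
      w₀ * (p * c) ≈ t * P →
      w₁ * (p * (c * (# 1ℤ - e))) ≈ q * κ * t * (# 1ℤ - x) * P →
      w₂ * (p * (c * (# 1ℤ - e) * (# 1ℤ - q * e))) ≈ q * κ * (q * κ) * t * (q - x) * (# 1ℤ - x) * P →
      (y * (w₂ + w₀) + (# 1ℤ + y * y) * w₁) * (p * (c * (# 1ℤ - e) * (# 1ℤ - q * e)))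
      ≈ q * κ * t * (P * (# 1ℤ - f) * (# 1ℤ - q * f))
    W-suc-algebra {w₀} {w₁} {w₂} {p} {c} {t} {P} {κ} {x} h₀ h₁ h₂ = begin
      (y * (w₂ + w₀) + (# 1ℤ + y * y) * w₁) * (p * (c * (# 1ℤ - e) * (# 1ℤ - q * e)))
        ≈⟨ solve 8 (λ q w₀ w₁ w₂ p c e y →
             (y :* (w₂ :+ w₀) :+ (con 1ℤ :+ y :* y) :* w₁) :* (p :* (c :* (con 1ℤ :- e) :* (con 1ℤ :- q :* e)))
             := y :* (w₂ :* (p :* (c :* (con 1ℤ :- e) :* (con 1ℤ :- q :* e))))
               :+ y :* (con 1ℤ :- e) :* (con 1ℤ :- q :* e) :* (w₀ :* (p :* c))
               :+ (con 1ℤ :+ y :* y) :* (con 1ℤ :- q :* e) :* (w₁ :* (p :* (c :* (con 1ℤ :- e)))))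
             refl q w₀ w₁ w₂ p c e y ⟩
      y * (w₂ * (p * (c * (# 1ℤ - e) * (# 1ℤ - q * e))))
        + y * (# 1ℤ - e) * (# 1ℤ - q * e) * (w₀ * (p * c))
        + (# 1ℤ + y * y) * (# 1ℤ - q * e) * (w₁ * (p * (c * (# 1ℤ - e))))
        ≈⟨ +-cong (+-cong (*-congˡ h₂) (*-congˡ h₀)) (*-congˡ h₁) ⟩
      y * (q * κ * (q * κ) * t * (q - x) * (# 1ℤ - x) * P)
        + y * (# 1ℤ - e) * (# 1ℤ - q * e) * (t * P)
        + (# 1ℤ + y * y) * (# 1ℤ - q * e) * (q * κ * t * (# 1ℤ - x) * P)
        ≈⟨ solve 5 (λ q t P κ x →
             let e = q :* (q :* (κ :* (κ :* x))) ; y = q :* (κ :* x) ; f = q :* (q :* (κ :* x :* (κ :* x))) in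
             y :* (q :* κ :* (q :* κ) :* t :* (q :- x) :* (con 1ℤ :- x) :* P)
               :+ y :* (con 1ℤ :- e) :* (con 1ℤ :- q :* e) :* (t :* P)
               :+ (con 1ℤ :+ y :* y) :* (con 1ℤ :- q :* e) :* (q :* κ :* t :* (con 1ℤ :- x) :* P)
             := q :* κ :* t :* (P :* (con 1ℤ :- f) :* (con 1ℤ :- q :* f)))
             refl q t P κ x ⟩
      q * κ * t * (P * (# 1ℤ - f) * (# 1ℤ - q * f)) ∎
      where
      open ≈-Reasoning setoid
      e = q * (q * (κ * (κ * x)))
      y = q * (κ * x)
      f = q * (q * (κ * x * (κ * x)))

  -- The Gaussian binomial [2n+1 choose n-k] with denominators cleared. The recurrence of `W` is
  -- multiplication by (1 - z q^(n+1))(1 - z⁻¹ q^(n+1)) with the sign (-1)^k removed, so the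
  -- induction on n brings the closed forms at k, k + 1 and k + 2 over one denominator.
  W-closed : ∀ {n} k d → n ≡ k ℕ.+ d → W n k * (poch d * poch (suc (k ℕ.+ n))) ≈ τ k * poch (suc (n ℕ.+ n))
  private
    vanishing : ∀ {w x y z} → w ≈ # 0ℤ → y ≈ # 0ℤ → w * x ≈ y * z
    vanishing w≈0 y≈0 = trans (trans (*-congʳ w≈0) (zeroˡ _)) (sym (trans (*-congʳ y≈0) (zeroˡ _)))

    W-closed₁ : ∀ {n} k d → n ≡ k ℕ.+ d →
      W n (1 ℕ.+ k) * (poch d * poch (suc (1 ℕ.+ k ℕ.+ n))) ≈ q * q ^ k * τ k * (# 1ℤ - q ^ d) * poch (suc (n ℕ.+ n))
    W-closed₁ {n} k zero n≡ = vanishing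
      (W-vanish (s≤s (ℕ.≤-reflexive (≡.trans n≡ (ℕ.+-identityʳ k)))))
      (solve 3 (λ q κ t → q :* κ :* t :* (con 1ℤ :- con 1ℤ) := con 0ℤ) refl q (q ^ k) (τ k))
    W-closed₁ {n} k (suc d) n≡ = begin
      w * (poch d * z * c)  ≈⟨ solve 4 (λ w p z c → w :* (p :* z :* c) := w :* (p :* c) :* z) refl w (poch d) z c ⟩
      w * (poch d * c) * z  ≈⟨ *-congʳ (W-closed (suc k) d (≡.trans n≡ (ℕ.+-suc k d))) ⟩
      τ (suc k) * P * z     ≈⟨ solve 3 (λ t P z → t :* P :* z := t :* z :* P) refl (τ (suc k)) P z ⟩
      τ (suc k) * z * P     ∎
      where
      open ≈-Reasoning setoid
      w = W n (1 ℕ.+ k)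
      c = poch (suc (1 ℕ.+ k ℕ.+ n))
      z = # 1ℤ - q ^ suc d
      P = poch (suc (n ℕ.+ n))

    -- The factor `q - q ^ d` is q (1 - q^(d-1)) with one q borrowed from `τ (2 + k)`. No exponent d
    -- - 1 occurs, and the right side vanishes by itself at d = 0 and d = 1, where `W` lies outside
    -- its support.
    W-closed₂ : ∀ {n} k d → n ≡ k ℕ.+ d →
      W n (2 ℕ.+ k) * (poch d * poch (suc (2 ℕ.+ k ℕ.+ n))) ≈
      q * q ^ k * (q * q ^ k) * τ k * (q - q ^ d) * (# 1ℤ - q ^ d) * poch (suc (n ℕ.+ n))
    W-closed₂ {n} k zero n≡ = vanishing
      (W-vanish (s≤s (ℕ.m≤n⇒m≤1+n (ℕ.≤-reflexive (≡.trans n≡ (ℕ.+-identityʳ k))))))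
      (solve 2 (λ x y → x :* y :* (con 1ℤ :- con 1ℤ) := con 0ℤ) refl (q * q ^ k * (q * q ^ k) * τ k) (q - # 1ℤ))
    W-closed₂ {n} k (suc zero) n≡ = vanishing
      (W-vanish (s≤s (ℕ.≤-reflexive (≡.trans n≡ (ℕ.+-comm k 1)))))
      (solve 2 (λ q x → x :* (q :- q :* con 1ℤ) :* (con 1ℤ :- q :* con 1ℤ) := con 0ℤ) refl q (q * q ^ k * (q * q ^ k) * τ k))
    W-closed₂ {n} k (suc (suc d)) n≡ = begin
      w * (poch d * z * z′ * c)
        ≈⟨ solve 5 (λ w p z z′ c → w :* (p :* z :* z′ :* c) := w :* (p :* c) :* (z :* z′)) refl w (poch d) z z′ c ⟩
      w * (poch d * c) * (z * z′)
        ≈⟨ *-congʳ (W-closed (2 ℕ.+ k) d (≡.trans n≡ (≡.trans (ℕ.+-suc k (suc d)) (≡.cong suc (ℕ.+-suc k d))))) ⟩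
      τ (2 ℕ.+ k) * P * (z * z′)
        ≈⟨ solve 5 (λ q κ t P x →
             q :* (q :* κ) :* (q :* κ :* t) :* P :* ((con 1ℤ :- q :* x) :* (con 1ℤ :- q :* (q :* x)))
             := q :* κ :* (q :* κ) :* t :* (q :- q :* (q :* x)) :* (con 1ℤ :- q :* (q :* x)) :* P)
             refl q (q ^ k) (τ k) P (q ^ d) ⟩
      q * q ^ k * (q * q ^ k) * τ k * (q - q ^ (2 ℕ.+ d)) * z′ * P ∎
      where
      open ≈-Reasoning setoid
      w = W n (2 ℕ.+ k)
      c = poch (suc (2 ℕ.+ k ℕ.+ n))
      z = # 1ℤ - q ^ suc d
      z′ = # 1ℤ - q ^ suc (suc d)
      P = poch (suc (n ℕ.+ n))

  W-closed {zero} zero zero ≡.refl = sym (solve 1 (λ p → con 1ℤ :* p := con 1ℤ :* (con 1ℤ :* p)) refl (poch 1))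
  W-closed {zero} (suc k) d ()
  W-closed {suc n} zero .(suc n) ≡.refl rewrite ℕ.+-suc n n = begin
    W (suc n) 0 * (poch (suc n) * poch (suc (suc n)))
      ≈⟨ W-zero-algebra {W n 0} {W n 1} {poch n} {q ^ n}
           (trans (W-closed 0 n ≡.refl) (*-identityˡ _))
           (trans (W-closed₁ 0 n ≡.refl) (solve 3 (λ q y P → q :* con 1ℤ :* con 1ℤ :* y :* P := q :* y :* P) refl q (# 1ℤ - q ^ n) P)) ⟩
    P * (# 1ℤ - q * (q * (q ^ n * q ^ n))) * (# 1ℤ - q * (q * (q * (q ^ n * q ^ n))))
      ≈⟨ sym (trans (*-identityˡ _) (trans (poch-suc (2 ℕ.+ (n ℕ.+ n)) (*-congˡ (*-congˡ qq)))
           (*-congʳ (poch-suc (1 ℕ.+ (n ℕ.+ n)) (*-congˡ qq))))) ⟩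
    # 1ℤ * poch (suc (suc (suc (n ℕ.+ n)))) ∎
    where
    open ≈-Reasoning setoid
    P = poch (suc (n ℕ.+ n))
    qq : q ^ (n ℕ.+ n) ≈ q ^ n * q ^ n
    qq = ^-homo-* q n n
  W-closed {suc n} (suc k) d 1+n≡ rewrite ℕ.+-suc n n | ℕ.+-suc k n = begin
    W (suc n) (suc k) * (poch d * poch (suc (2 ℕ.+ k ℕ.+ n)))
      ≈⟨ *-cong (+-cong (*-congʳ qY) (*-congʳ (+-congˡ (*-cong qY qY)))) (*-congˡ c₂) ⟩
    (y * (W n (2 ℕ.+ k) + W n k) + (# 1ℤ + y * y) * W n (1 ℕ.+ k)) * (poch d * (c * (# 1ℤ - e) * (# 1ℤ - q * e)))
      ≈⟨ W-suc-algebra {W n k} {W n (1 ℕ.+ k)} {W n (2 ℕ.+ k)} {poch d} {c} {τ k} {P} {q ^ k} {q ^ d}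
           (W-closed k d n≡)
           (trans (*-congˡ (*-congˡ (sym c₁))) (W-closed₁ k d n≡))
           (trans (*-congˡ (*-congˡ (sym c₂))) (W-closed₂ k d n≡)) ⟩
    q * q ^ k * τ k * (P * (# 1ℤ - f) * (# 1ℤ - q * f))
      ≈⟨ *-congˡ (sym (trans (poch-suc (2 ℕ.+ (n ℕ.+ n)) (*-congˡ (*-congˡ qq))) (*-congʳ (poch-suc (1 ℕ.+ (n ℕ.+ n)) (*-congˡ qq))))) ⟩
    q * q ^ k * τ k * poch (suc (suc (suc (n ℕ.+ n)))) ∎
    where
    open ≈-Reasoning setoid
    n≡ : n ≡ k ℕ.+ d
    n≡ = ℕ.suc-injective 1+n≡
    P = poch (suc (n ℕ.+ n))
    c = poch (suc (k ℕ.+ n))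
    e = q * (q * (q ^ k * (q ^ k * q ^ d)))
    y = q * (q ^ k * q ^ d)
    f = q * (q * (q ^ k * q ^ d * (q ^ k * q ^ d)))
    qn : q ^ n ≈ q ^ k * q ^ d
    qn = trans (reflexive (≡.cong (q ^_) n≡)) (^-homo-* q k d)
    qY : q ^ suc n ≈ y
    qY = *-congˡ qn
    qq : q ^ (n ℕ.+ n) ≈ q ^ k * q ^ d * (q ^ k * q ^ d)
    qq = trans (^-homo-* q n n) (*-cong qn qn)
    qe : q ^ (k ℕ.+ n) ≈ q ^ k * (q ^ k * q ^ d)
    qe = trans (^-homo-* q k n) (*-congˡ qn)
    c₁ : poch (suc (1 ℕ.+ k ℕ.+ n)) ≈ c * (# 1ℤ - e)
    c₁ = poch-suc (1 ℕ.+ (k ℕ.+ n)) (*-congˡ qe)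
    c₂ : poch (suc (2 ℕ.+ k ℕ.+ n)) ≈ c * (# 1ℤ - e) * (# 1ℤ - q * e)
    c₂ = trans (poch-suc (2 ℕ.+ (k ℕ.+ n)) (*-congˡ (*-congˡ qe))) (*-congʳ c₁)

  ε μ : ℕ → ℤ⟦q⟧
  ε zero    = # 1ℤ
  ε (suc k) = - ε k
  μ zero    = # 1ℤ
  μ (suc k) = μ k + # (+ 2)

  ∑ : (ℕ → ℤ⟦q⟧) → ℕ → ℤ⟦q⟧
  ∑ f zero    = # 0ℤ
  ∑ f (suc k) = ∑ f k + f k

  ∑-cong≤ : ∀ {f g n} K → (∀ {k} → k < K → f k ≈ g k upto n) → ∑ f K ≈ ∑ g K upto n
  ∑-cong≤ zero    p = ≤refl
  ∑-cong≤ (suc K) p = +-cong≤ (∑-cong≤ K λ k<K → p (ℕ.m≤n⇒m≤1+n k<K)) (p ℕ.≤-refl)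

  ∑-*ʳ : ∀ f c K → ∑ f K * c ≈ ∑ (λ k → f k * c) K
  ∑-*ʳ f c zero    = zeroˡ c
  ∑-*ʳ f c (suc K) =
    trans (solve 3 (λ s x c → (s :+ x) :* c := s :* c :+ x :* c) refl (∑ f K) (f K) c) (+-congʳ (∑-*ʳ f c K))

  theta : ℕ → ℕ → ℤ⟦q⟧
  theta n = ∑ λ k → ε k * μ k * W n k

  -- Collecting the terms with a given `W n k` yields (1 + Y²) μ_k - Y (μ_(k-1) + μ_(k+1)) = (1 -
  -- Y)² μ_k, because `μ` is an arithmetic progression; at k = 0 the folded term acts as μ_(-1) =
  -- -1. Only the upper end of the sum leaves a boundary term.
  theta-suc : ∀ n K → let Y = q ^ suc n in
    theta (suc n) (suc K) ≈
    (# 1ℤ - Y) * (# 1ℤ - Y) * theta n (suc K) + ε K * Y * (μ K * W n (suc K) + (μ K + # (+ 2)) * W n K)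
  theta-suc n zero =
    solve 3 (λ Y w₀ w₁ →
      con 0ℤ :+ con 1ℤ :* con 1ℤ :* (Y :* (w₁ :+ w₀) :+ (con 1ℤ :+ Y :* Y) :* w₀) :=
      (con 1ℤ :- Y) :* (con 1ℤ :- Y) :* (con 0ℤ :+ con 1ℤ :* con 1ℤ :* w₀)
        :+ con 1ℤ :* Y :* (con 1ℤ :* w₁ :+ (con 1ℤ :+ con (+ 2)) :* w₀))
      refl (q ^ suc n) (W n 0) (W n 1)
  theta-suc n (suc K) = trans (+-congʳ (theta-suc n K))
    (solve 7 (λ Y S ε μ w₀ w₁ w₂ →
      (con 1ℤ :- Y) :* (con 1ℤ :- Y) :* S :+ ε :* Y :* (μ :* w₁ :+ (μ :+ con (+ 2)) :* w₀)
        :+ (:- ε) :* (μ :+ con (+ 2)) :* (Y :* (w₂ :+ w₀) :+ (con 1ℤ :+ Y :* Y) :* w₁) :=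
      (con 1ℤ :- Y) :* (con 1ℤ :- Y) :* (S :+ (:- ε) :* (μ :+ con (+ 2)) :* w₁)
        :+ (:- ε) :* Y :* ((μ :+ con (+ 2)) :* w₂ :+ (μ :+ con (+ 2) :+ con (+ 2)) :* w₁))
      refl (q ^ suc n) (theta n (suc K)) (ε K) (μ K) (W n K) (W n (suc K)) (W n (2 ℕ.+ K)))

  -- This is the derivative at z = 1 of the finite triple product: the factor 1 - z⁻¹ leaves the
  -- square of (q;q)_n, and pairing k with -1 - k turns the weight k into 2k + 1.
  theta-product : ∀ n {K} → n < K → theta n K ≈ poch n * poch n
  theta-product zero {suc zero}    _ = solve 0 (con 0ℤ :+ con 1ℤ :* con 1ℤ :* con 1ℤ := con 1ℤ :* con 1ℤ) refl
  theta-product zero {suc (suc K)} _ = trans (+-cong (theta-product zero {suc K} (s≤s z≤n)) (zeroʳ _)) (+-identityʳ _)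
  theta-product (suc n) {suc K} (s≤s n<K) = begin
    theta (suc n) (suc K)
      ≈⟨ theta-suc n K ⟩
    (# 1ℤ - Y) * (# 1ℤ - Y) * theta n (suc K) + ε K * Y * (μ K * W n (suc K) + (μ K + # (+ 2)) * W n K)
      ≈⟨ +-cong (*-congˡ (theta-product n (ℕ.m≤n⇒m≤1+n n<K)))
           (*-congˡ (+-cong (*-congˡ (W-vanish (ℕ.m≤n⇒m≤1+n n<K))) (*-congˡ (W-vanish n<K)))) ⟩
    (# 1ℤ - Y) * (# 1ℤ - Y) * (poch n * poch n) + ε K * Y * (μ K * # 0ℤ + (μ K + # (+ 2)) * # 0ℤ)
      ≈⟨ solve 4 (λ Y p ε μ →
           (con 1ℤ :- Y) :* (con 1ℤ :- Y) :* (p :* p) :+ ε :* Y :* (μ :* con 0ℤ :+ (μ :+ con (+ 2)) :* con 0ℤ)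
           := p :* (con 1ℤ :- Y) :* (p :* (con 1ℤ :- Y))) refl Y (poch n) (ε K) (μ K) ⟩
    poch (suc n) * poch (suc n) ∎
    where
    open ≈-Reasoning setoid
    Y = q ^ suc n

  -- In the closed form the long products agree with φ up to n, but (q;q)_d with d = n - k only up
  -- to d. The lost k orders are recovered because `τ k` is divisible by q^k, which is what
  -- `τ-absorb` uses.
  W-limit : ∀ {n} k → k ≤ n → W n k * φ ≈ τ k upto n
  W-limit {n} k k≤n with d , ≡.refl ← ℕ.m≤n⇒∃[o]m+o≡n k≤n = begin
    W n k * φ
      ≈⟨ ≈⇒upto (sym (trans (*-congˡ φ⁻¹*φ≈1) (*-identityʳ _))) ⟩
    W n k * φ * (φ⁻¹ * φ)
      ≈⟨ ≈⇒upto (sym (trans (*-congˡ (poch⁻¹-inverse d)) (*-identityʳ _))) ⟩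
    W n k * φ * (φ⁻¹ * φ) * (poch⁻¹ d * poch d)
      ≈⟨ ≈⇒upto (solve 5 (λ w f g p r → w :* f :* (g :* f) :* (r :* p) := w :* (p :* f) :* (g :* f :* r))
           refl (W n k) φ φ⁻¹ (poch d) (poch⁻¹ d)) ⟩
    W n k * (poch d * φ) * (φ⁻¹ * φ * poch⁻¹ d)
      ≈⟨ *-cong≤ (*-cong≤ ≤refl (*-cong≤ ≤refl (φ-upto (ℕ.m≤n⇒m≤1+n (ℕ.m≤n+m n k))))) ≤refl ⟩
    W n k * (poch d * poch (suc (k ℕ.+ n))) * (φ⁻¹ * φ * poch⁻¹ d)
      ≈⟨ ≈⇒upto (*-congʳ (W-closed k d ≡.refl)) ⟩
    τ k * poch (suc (n ℕ.+ n)) * (φ⁻¹ * φ * poch⁻¹ d)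
      ≈⟨ *-cong≤ (*-cong≤ ≤refl (≤sym (φ-upto (ℕ.m≤n⇒m≤1+n (ℕ.m≤n+m n n))))) ≤refl ⟩
    τ k * φ * (φ⁻¹ * φ * poch⁻¹ d)
      ≈⟨ ≈⇒upto (solve 4 (λ t f g r → t :* f :* (g :* f :* r) := t :* (r :* f) :* (g :* f)) refl (τ k) φ φ⁻¹ (poch⁻¹ d)) ⟩
    τ k * (poch⁻¹ d * φ) * (φ⁻¹ * φ)
      ≈⟨ ≈⇒upto (trans (*-congˡ φ⁻¹*φ≈1) (*-identityʳ _)) ⟩
    τ k * (poch⁻¹ d * φ)
      ≈⟨ τ-absorb k (≤trans (*-cong≤ ≤refl (φ-upto ℕ.≤-refl)) (≈⇒upto (poch⁻¹-inverse d))) ⟩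
    τ k * # 1ℤ
      ≈⟨ ≈⇒upto (*-identityʳ (τ k)) ⟩
    τ k ∎
    where
    open ≈-Reasoning (upto-setoid (k ℕ.+ d))
    τ-absorb : ∀ k {d f g} → f ≈ g upto d → τ k * f ≈ τ k * g upto (k ℕ.+ d)
    τ-absorb zero    p = *-cong≤ ≤refl p
    τ-absorb (suc k) {d} {f} {g} p =
      ≤trans (≈⇒upto (*-assoc (q ^ suc k) (τ k) f))
        (≤trans (q^*-cong≤ (suc k) (*-cong≤ ≤refl p)) (≈⇒upto (sym (*-assoc (q ^ suc k) (τ k) g))))

  jacobi : ∀ n → φ ^ 3 ≈ ∑ (λ k → ε k * μ k * τ k) (suc n) upto n
  jacobi n = begin
    φ ^ 3
      ≈⟨ *-cong≤ (φ-upto ℕ.≤-refl) (*-cong≤ (φ-upto ℕ.≤-refl) (≈⇒upto (*-identityʳ φ))) ⟩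
    poch n * (poch n * φ)
      ≈⟨ ≈⇒upto (sym (*-assoc (poch n) (poch n) φ)) ⟩
    poch n * poch n * φ
      ≈⟨ ≈⇒upto (*-congʳ (sym (theta-product n ℕ.≤-refl))) ⟩
    theta n (suc n) * φ
      ≈⟨ ≈⇒upto (∑-*ʳ (λ k → ε k * μ k * W n k) φ (suc n)) ⟩
    ∑ (λ k → ε k * μ k * W n k * φ) (suc n)
      ≈⟨ ∑-cong≤ (suc n) (λ {k} k<1+n →
           ≤trans (≈⇒upto (*-assoc (ε k * μ k) (W n k) φ)) (*-cong≤ ≤refl (W-limit k (ℕ.≤-pred k<1+n)))) ⟩
    ∑ (λ k → ε k * μ k * τ k) (suc n) ∎
    where open ≈-Reasoning (upto-setoid n)

  private
    J : ℕ → ℤ⟦q⟧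
    J = ∑ λ k → ε k * μ k * τ k

    V-ε : ∀ k → V (ε k) ≈ ε k
    V-ε zero    = V-# 1ℤ
    V-ε (suc k) = trans (V-neg (ε k)) (-‿cong (V-ε k))

    V-μ : ∀ k → V (μ k) ≈ μ k
    V-μ zero    = V-# 1ℤ
    V-μ (suc k) = trans (V-+ (μ k) _) (+-cong (V-μ k) (V-# (+ 2)))

    V-term : ∀ k f → V (ε k * μ k * f) ≈ ε k * μ k * V f
    V-term k f = trans (V-* (ε k * μ k) f) (*-congʳ (trans (V-* (ε k) (μ k)) (*-cong (V-ε k) (V-μ k))))

    ε-3* : ∀ m → ε (m ℕ.* 3) ≈ ε m
    ε-3* zero    = refl
    ε-3* (suc m) = trans (solve 1 (λ x → :- (:- (:- x)) := :- x) refl (ε (m ℕ.* 3))) (-‿cong (ε-3* m))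

    μ-1+3* : ∀ m → μ (1 ℕ.+ m ℕ.* 3) ≈ # (+ 3) * μ m
    μ-1+3* zero    = solve 0 (con 1ℤ :+ con (+ 2) := con (+ 3) :* con 1ℤ) refl
    μ-1+3* (suc m) = trans (+-congʳ (+-congʳ (+-congʳ (μ-1+3* m))))
      (solve 1 (λ x → con (+ 3) :* x :+ con (+ 2) :+ con (+ 2) :+ con (+ 2) := con (+ 3) :* (x :+ con (+ 2))) refl (μ m))

    τ-1+3* : ∀ m → τ (1 ℕ.+ m ℕ.* 3) ≈ q * V (V (τ m))
    τ-2+3* : ∀ m → τ (2 ℕ.+ m ℕ.* 3) ≈ V (q ^ suc m * V (τ m))
    τ-3*   : ∀ m → ∃[ h ] τ (m ℕ.* 3) ≈ V h

    τ-1+3* zero    = trans (*-identityʳ _) (*-congˡ (sym (trans (V-cong (V-# 1ℤ)) (V-# 1ℤ))))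
    τ-1+3* (suc m) = begin
      q ^ (4 ℕ.+ m ℕ.* 3) * (q ^ (3 ℕ.+ m ℕ.* 3) * τ (2 ℕ.+ m ℕ.* 3))
        ≈⟨ *-cong (*-congˡ (q^*3 (suc m))) (*-cong (q^*3 (suc m)) (τ-2+3* m)) ⟩
      q * x * (x * V (q ^ suc m * V (τ m)))
        ≈⟨ *-congˡ (*-congˡ (V-* _ _)) ⟩
      q * x * (x * (x * V (V (τ m))))
        ≈⟨ solve 3 (λ q x t → q :* x :* (x :* (x :* t)) := q :* (x :^ 3 :* t)) refl q x (V (V (τ m))) ⟩
      q * (x ^ 3 * V (V (τ m)))
        ≈⟨ *-congˡ (*-congʳ (V-^ (q ^ suc m) 3)) ⟨
      q * (V ((q ^ suc m) ^ 3) * V (V (τ m)))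
        ≈⟨ *-congˡ (V-* _ _) ⟨
      q * V ((q ^ suc m) ^ 3 * V (τ m))
        ≈⟨ *-congˡ (V-cong (*-congʳ (trans (^-assocʳ q (suc m) 3) (q^*3 (suc m))))) ⟩
      q * V (V (q ^ suc m) * V (τ m))
        ≈⟨ *-congˡ (V-cong (V-* _ _)) ⟨
      q * V (V (τ (suc m))) ∎
      where
      open ≈-Reasoning setoid
      x = V (q ^ suc m)

    τ-2+3* m = begin
      q * (q * q ^ (m ℕ.* 3)) * τ (1 ℕ.+ m ℕ.* 3)     ≈⟨ *-congˡ (τ-1+3* m) ⟩
      q * (q * q ^ (m ℕ.* 3)) * (q * V (V (τ m)))
        ≈⟨ solve 3 (λ q x t → q :* (q :* x) :* (q :* t) := q :* (q :* (q :* x)) :* t)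
        refl q (q ^ (m ℕ.* 3)) (V (V (τ m))) ⟩
      q ^ (suc m ℕ.* 3) * V (V (τ m))                 ≈⟨ *-congʳ (q^*3 (suc m)) ⟩
      V (q ^ suc m) * V (V (τ m))                     ≈⟨ V-* _ _ ⟨
      V (q ^ suc m * V (τ m))                         ∎
      where open ≈-Reasoning setoid

    τ-3* zero    = # 1ℤ , sym (V-# 1ℤ)
    τ-3* (suc m) = q ^ suc m * (q ^ suc m * V (τ m)) ,
      trans (*-cong (q^*3 (suc m)) (τ-2+3* m)) (sym (V-* _ _))

    -- k(k+1)/2 is ≡ 1 mod 3 exactly for k = 3j + 1 and is never ≡ 2. For such k the exponent is 1 +
    -- 9 j(j+1)/2, the weight 2k + 1 is 3(2j + 1) and the sign flips, so this class is -3q times the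
    -- same sum at q⁹. The rest, `h`, may stay unspecified.
    J-dissection : ∀ m → ∃[ h ] J (m ℕ.* 3) ≈ V h + q * V (# -3ℤ * V (J m))
    V-V-term : ∀ f → V (# -3ℤ * V f) ≈ # -3ℤ * V (V f)
    V-V-term f = trans (V-* (# -3ℤ) (V f)) (*-congʳ (V-# -3ℤ))

    J-dissection zero    = # 0ℤ , sym (begin
      V (# 0ℤ) + q * V (# -3ℤ * V (# 0ℤ))   ≈⟨ +-cong (V-# 0ℤ) (*-congˡ (trans (V-V-term (# 0ℤ)) (*-congˡ (trans (V-cong (V-# 0ℤ)) (V-# 0ℤ))))) ⟩
      # 0ℤ + q * (# -3ℤ * # 0ℤ)             ≈⟨ solve 1 (λ q → con 0ℤ :+ q :* (con -3ℤ :* con 0ℤ) := con 0ℤ) refl q ⟩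
      # 0ℤ                                  ∎)
      where open ≈-Reasoning setoid
    J-dissection (suc m) with h , p ← J-dissection m | h′ , p′ ← τ-3* m =
      h + t₀ + t₂ , (begin
      J (m ℕ.* 3) + ε k * μ k * τ k + ε (1 ℕ.+ k) * μ (1 ℕ.+ k) * τ (1 ℕ.+ k) + ε (2 ℕ.+ k) * μ (2 ℕ.+ k) * τ (2 ℕ.+ k)
        ≈⟨ +-cong (+-cong (+-cong (trans p (+-congˡ (*-congˡ (V-V-term (J m)))))
             (trans (*-congˡ p′) (sym (V-term k h′))))
             (*-cong (*-cong (-‿cong (ε-3* m)) (μ-1+3* m)) (τ-1+3* m)))
             (trans (*-congˡ (τ-2+3* m)) (sym (V-term (2 ℕ.+ k) (q ^ suc m * V (τ m))))) ⟩
      V h + q * (# -3ℤ * V (V (J m))) + V t₀ + (- ε m) * (# (+ 3) * μ m) * (q * V (V (τ m))) + V t₂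
        ≈⟨ solve 8 (λ q h j a e u t b →
             h :+ q :* (con -3ℤ :* j) :+ a :+ (:- e) :* (con (+ 3) :* u) :* (q :* t) :+ b :=
             h :+ a :+ b :+ q :* (con -3ℤ :* (j :+ e :* u :* t)))
             refl q (V h) (V (V (J m))) (V t₀) (ε m) (μ m) (V (V (τ m))) (V t₂) ⟩
      V h + V t₀ + V t₂ + q * (# -3ℤ * (V (V (J m)) + ε m * μ m * V (V (τ m))))
        ≈⟨ +-cong (trans (V-+ _ _) (+-congʳ (V-+ _ _)))
             (*-congˡ (trans (V-V-term (J (suc m))) (*-congˡ (trans (V-cong (V-+ _ _)) (trans (V-+ _ _)
               (+-congˡ (trans (V-cong (V-term m (τ m))) (V-term m (V (τ m)))))))))) ⟨
      V (h + t₀ + t₂) + q * V (# -3ℤ * V (J (suc m))) ∎)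
      where
      open ≈-Reasoning setoid
      k = m ℕ.* 3
      t₀ = ε k * μ k * h′
      t₂ = ε (2 ℕ.+ k) * μ (2 ℕ.+ k) * (q ^ suc m * V (τ m))

    jacobi′ : ∀ {n K} → n < K → φ ^ 3 ≈ J K upto n
    jacobi′ {n} {suc K} (s≤s n≤K) = upto-weaken n≤K (jacobi K)

    J-sections : ∀ m → U 1 (J (m ℕ.* 3)) ≈ # -3ℤ * V (J m) × U 2 (J (m ℕ.* 3)) ≈ # 0ℤ
    J-sections m with h , p ← J-dissection m
      with _ , p₁ , p₂ ← sections h (# -3ℤ * V (J m)) (# 0ℤ) =
      trans (U-cong 1 p′) p₁ , trans (U-cong 2 p′) p₂
      where
      p′ : J (m ℕ.* 3) ≈ V h + q * (V (# -3ℤ * V (J m)) + q * V (# 0ℤ))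
      p′ = trans p (+-congˡ (*-congˡ (sym (trans (+-congˡ (trans (*-congˡ (V-# 0ℤ)) (zeroʳ q))) (+-identityʳ _)))))

  U1-φ³ : U 1 (φ ^ 3) ≈ # -3ℤ * V (φ ^ 3)
  U1-φ³ = upto⇒≈ λ n → ≤trans
    -- Coefficients up to 3n + 1 are needed. A sum of 3(n + 1) terms covers them, and its middle
    -- section is expressed by `J (suc n)`, the very sum in `jacobi n`.
    (U-cong≤ 1 (jacobi′ {K = suc n ℕ.* 3} (s≤s (s≤s (ℕ.n≤1+n (n ℕ.* 3))))))
    (≤trans (≈⇒upto (proj₁ (J-sections (suc n))))
      (*-cong≤ ≤refl (V-cong≤ (≤sym (jacobi n)))))

  U2-φ³ : U 2 (φ ^ 3) ≈ # 0ℤ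
  U2-φ³ = upto⇒≈ λ n → ≤trans
    (U-cong≤ 2 (jacobi′ {K = suc n ℕ.* 3} ℕ.≤-refl))
    (≈⇒upto (proj₂ (J-sections (suc n))))

-- The cubic norm of a series and the inversion of φ³.

module CubicNorm where

  open import Data.Integer.Base as ℤ using (+_; 0ℤ; 1ℤ)
  open import Data.Nat.Base as ℕ using (ℕ; zero; suc)
  import Data.Nat.Properties as ℕ
  open import Data.Product using (_,_)
  import Relation.Binary.Reasoning.Setoid as ≈-Reasoning
  open PowerSeries
  open Dissection
  open EulerProduct
  open Jacobi
  open ≈-Reasoning setoid

  -- The norm form of the cubic extension x³ = q: the norm of a + b x + c x².
  cubic : ℤ⟦q⟧ → ℤ⟦q⟧ → ℤ⟦q⟧ → ℤ⟦q⟧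
  cubic a b c = a ^ 3 + q * b ^ 3 + q ^ 2 * c ^ 3 - # (+ 3) * q * (a * b * c)

  cubic-cong≤ : ∀ {a a′ b b′ c c′ n} → a ≈ a′ upto n → b ≈ b′ upto n → c ≈ c′ upto n →
                cubic a b c ≈ cubic a′ b′ c′ upto n
  cubic-cong≤ p r s =
    +-cong≤ (+-cong≤ (+-cong≤ (^-cong≤ 3 p) (*-cong≤ ≤refl (^-cong≤ 3 r))) (*-cong≤ ≤refl (^-cong≤ 3 s)))
            (-‿cong≤ (*-cong≤ ≤refl (*-cong≤ (*-cong≤ p r) s)))

  cubic-cong : ∀ {a a′ b b′ c c′} → a ≈ a′ → b ≈ b′ → c ≈ c′ → cubic a b c ≈ cubic a′ b′ c′
  cubic-cong p r s = upto⇒≈ λ _ → cubic-cong≤ (≈⇒upto p) (≈⇒upto r) (≈⇒upto s)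

  -- V (norm f) is the product of f(ζq) over the cube roots of unity ζ.
  norm : ℤ⟦q⟧ → ℤ⟦q⟧
  norm f = cubic (U 0 f) (U 1 f) (U 2 f)

  norm-cong : ∀ {f g} → f ≈ g → norm f ≈ norm g
  norm-cong p = cubic-cong (U-cong 0 p) (U-cong 1 p) (U-cong 2 p)

  norm-cong≤ : ∀ {f g n} → f ≈ g upto (2 ℕ.+ n ℕ.* 3) → norm f ≈ norm g upto n
  norm-cong≤ {n = n} p = cubic-cong≤
    (U-cong≤ 0 (upto-weaken (ℕ.m≤n+m (n ℕ.* 3) 2) p)) (U-cong≤ 1 (upto-weaken (ℕ.n≤1+n _) p)) (U-cong≤ 2 p)

  norm-sections : ∀ {f a b c} → f ≈ V a + q * (V b + q * V c) → norm f ≈ cubic a b c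
  norm-sections {a = a} {b} {c} p with p₀ , p₁ , p₂ ← sections a b c =
    cubic-cong (trans (U-cong 0 p) p₀) (trans (U-cong 1 p) p₁) (trans (U-cong 2 p) p₂)

  -- In the product of two dissections the exponents wrap around through q³ = `V q`, which becomes q
  -- after taking sections. What remains is multiplicativity of the norm form, an identity over ℤ.
  norm-* : ∀ f g → norm (f * g) ≈ norm f * norm g
  norm-* f g = begin
    norm (f * g)
      ≈⟨ norm-sections product ⟩
    cubic (f₀ * g₀ + q * (f₁ * g₂ + f₂ * g₁)) (f₀ * g₁ + f₁ * g₀ + q * (f₂ * g₂)) (f₀ * g₂ + f₁ * g₁ + f₂ * g₀)
      ≈⟨ solve 7 (λ q f₀ f₁ f₂ g₀ g₁ g₂ →
           let cb = λ a b c → a :^ 3 :+ q :* b :^ 3 :+ q :^ 2 :* c :^ 3 :- con (+ 3) :* q :* (a :* b :* c) in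
           cb (f₀ :* g₀ :+ q :* (f₁ :* g₂ :+ f₂ :* g₁)) (f₀ :* g₁ :+ f₁ :* g₀ :+ q :* (f₂ :* g₂)) (f₀ :* g₂ :+ f₁ :* g₁ :+ f₂ :* g₀)
           := cb f₀ f₁ f₂ :* cb g₀ g₁ g₂) refl q f₀ f₁ f₂ g₀ g₁ g₂ ⟩
    norm f * norm g ∎
    where
    f₀ = U 0 f
    f₁ = U 1 f
    f₂ = U 2 f
    g₀ = U 0 g
    g₁ = U 1 g
    g₂ = U 2 g
    VV* : ∀ a b c d → V (a * b + c * d) ≈ V a * V b + V c * V d
    VV* a b c d = trans (V-+ _ _) (+-cong (V-* a b) (V-* c d))
    product : f * g ≈ V (f₀ * g₀ + q * (f₁ * g₂ + f₂ * g₁))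
                    + q * (V (f₀ * g₁ + f₁ * g₀ + q * (f₂ * g₂)) + q * V (f₀ * g₂ + f₁ * g₁ + f₂ * g₀))
    product = begin
      f * g
        ≈⟨ *-cong (decompose f) (decompose g) ⟩
      (V f₀ + q * (V f₁ + q * V f₂)) * (V g₀ + q * (V g₁ + q * V g₂))
        ≈⟨ solve 7 (λ q f₀ f₁ f₂ g₀ g₁ g₂ →
             (f₀ :+ q :* (f₁ :+ q :* f₂)) :* (g₀ :+ q :* (g₁ :+ q :* g₂)) :=
             f₀ :* g₀ :+ q :^ 3 :* (f₁ :* g₂ :+ f₂ :* g₁)
               :+ q :* (f₀ :* g₁ :+ f₁ :* g₀ :+ q :^ 3 :* (f₂ :* g₂) :+ q :* (f₀ :* g₂ :+ f₁ :* g₁ :+ f₂ :* g₀)))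
             refl q (V f₀) (V f₁) (V f₂) (V g₀) (V g₁) (V g₂) ⟩
      V f₀ * V g₀ + q ^ 3 * (V f₁ * V g₂ + V f₂ * V g₁)
        + q * (V f₀ * V g₁ + V f₁ * V g₀ + q ^ 3 * (V f₂ * V g₂) + q * (V f₀ * V g₂ + V f₁ * V g₁ + V f₂ * V g₀))
        ≈⟨ +-cong
             (trans (V-+ _ _) (+-cong (V-* f₀ g₀) (trans (V-* q _) (*-cong V-q (VV* f₁ g₂ f₂ g₁)))))
             (*-congˡ (+-cong
               (trans (V-+ _ _) (+-cong (VV* f₀ g₁ f₁ g₀) (trans (V-* q _) (*-cong V-q (V-* f₂ g₂)))))
               (*-congˡ (trans (V-+ _ _) (+-cong (VV* f₀ g₂ f₁ g₁) (V-* f₂ g₀)))))) ⟨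
      V (f₀ * g₀ + q * (f₁ * g₂ + f₂ * g₁))
        + q * (V (f₀ * g₁ + f₁ * g₀ + q * (f₂ * g₂)) + q * V (f₀ * g₂ + f₁ * g₁ + f₂ * g₀)) ∎

  private
    V-neg-q^ : ∀ j → V (- (q ^ j)) ≈ - (q ^ (j ℕ.* 3))
    V-neg-q^ j = trans (V-neg (q ^ j)) (-‿cong (sym (q^*3 j)))

    q^3* : ∀ j → q ^ (j ℕ.* 3) ≈ (q ^ j) ^ 3
    q^3* j = sym (^-assocʳ q j 3)

    norm-1+3* : ∀ j → norm (# 1ℤ - q ^ (1 ℕ.+ j ℕ.* 3)) ≈ # 1ℤ - q ^ (1 ℕ.+ j ℕ.* 3)
    norm-1+3* j = begin
      norm (# 1ℤ - q ^ (1 ℕ.+ j ℕ.* 3))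
        ≈⟨ norm-sections (sym (begin
             V (# 1ℤ) + q * (V (- (q ^ j)) + q * V (# 0ℤ))
               ≈⟨ +-cong (V-# 1ℤ) (*-congˡ (+-cong (V-neg-q^ j) (*-congˡ (V-# 0ℤ)))) ⟩
             # 1ℤ + q * (- (q ^ (j ℕ.* 3)) + q * # 0ℤ)
               ≈⟨ solve 2 (λ q x → con 1ℤ :+ q :* (:- x :+ q :* con 0ℤ) := con 1ℤ :- q :* x) refl q (q ^ (j ℕ.* 3)) ⟩
             # 1ℤ - q ^ (1 ℕ.+ j ℕ.* 3) ∎)) ⟩
      cubic (# 1ℤ) (- (q ^ j)) (# 0ℤ)
        ≈⟨ solve 2 (λ q x → con 1ℤ :^ 3 :+ q :* (:- x) :^ 3 :+ q :^ 2 :* con 0ℤ :^ 3 :- con (+ 3) :* q :* (con 1ℤ :* (:- x) :* con 0ℤ)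
             := con 1ℤ :- q :* x :^ 3) refl q (q ^ j) ⟩
      # 1ℤ - q * (q ^ j) ^ 3
        ≈⟨ +-congˡ (-‿cong (*-congˡ (q^3* j))) ⟨
      # 1ℤ - q ^ (1 ℕ.+ j ℕ.* 3) ∎

    norm-2+3* : ∀ j → norm (# 1ℤ - q ^ (2 ℕ.+ j ℕ.* 3)) ≈ # 1ℤ - q ^ (2 ℕ.+ j ℕ.* 3)
    norm-2+3* j = begin
      norm (# 1ℤ - q ^ (2 ℕ.+ j ℕ.* 3))
        ≈⟨ norm-sections (sym (begin
             V (# 1ℤ) + q * (V (# 0ℤ) + q * V (- (q ^ j)))
               ≈⟨ +-cong (V-# 1ℤ) (*-congˡ (+-cong (V-# 0ℤ) (*-congˡ (V-neg-q^ j)))) ⟩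
             # 1ℤ + q * (# 0ℤ + q * - (q ^ (j ℕ.* 3)))
               ≈⟨ solve 2 (λ q x → con 1ℤ :+ q :* (con 0ℤ :+ q :* (:- x)) := con 1ℤ :- q :* (q :* x)) refl q (q ^ (j ℕ.* 3)) ⟩
             # 1ℤ - q ^ (2 ℕ.+ j ℕ.* 3) ∎)) ⟩
      cubic (# 1ℤ) (# 0ℤ) (- (q ^ j))
        ≈⟨ solve 2 (λ q x → con 1ℤ :^ 3 :+ q :* con 0ℤ :^ 3 :+ q :^ 2 :* (:- x) :^ 3 :- con (+ 3) :* q :* (con 1ℤ :* con 0ℤ :* (:- x))
             := con 1ℤ :- q :* (q :* x :^ 3)) refl q (q ^ j) ⟩
      # 1ℤ - q * (q * (q ^ j) ^ 3)
        ≈⟨ +-congˡ (-‿cong (*-congˡ (*-congˡ (q^3* j)))) ⟨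
      # 1ℤ - q ^ (2 ℕ.+ j ℕ.* 3) ∎

  V-1-q^ : ∀ j → V (# 1ℤ - q ^ j) ≈ # 1ℤ - q ^ (j ℕ.* 3)
  V-1-q^ j = trans (V-+ _ _) (+-cong (V-# 1ℤ) (V-neg-q^ j))

  norm-V : ∀ f → norm (V f) ≈ f ^ 3
  norm-V f = trans
    (norm-sections (sym (begin
      V f + q * (V (# 0ℤ) + q * V (# 0ℤ))  ≈⟨ +-congˡ (*-congˡ (+-cong (V-# 0ℤ) (*-congˡ (V-# 0ℤ)))) ⟩
      V f + q * (# 0ℤ + q * # 0ℤ)          ≈⟨ solve 2 (λ q x → x :+ q :* (con 0ℤ :+ q :* con 0ℤ) := x) refl q (V f) ⟩
      V f                                  ∎)))
    (solve 2 (λ q x → x :^ 3 :+ q :* con 0ℤ :^ 3 :+ q :^ 2 :* con 0ℤ :^ 3 :- con (+ 3) :* q :* (x :* con 0ℤ :* con 0ℤ) := x :^ 3) refl q f)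

  -- A factor 1 - q^j is its own norm if 3 does not divide j, while 1 - q^(3i) has norm (1 - q^i)³.
  -- Multiplying by `V (poch m)` restores the missing factors with exponent divisible by 3.
  norm-poch : ∀ m → norm (poch (m ℕ.* 3)) * V (poch m) ≈ poch (m ℕ.* 3) * poch m ^ 3
  norm-poch zero = begin
    norm (# 1ℤ) * V (# 1ℤ)  ≈⟨ *-cong (trans (norm-cong (sym (V-# 1ℤ))) (norm-V (# 1ℤ))) (V-# 1ℤ) ⟩
    # 1ℤ ^ 3 * # 1ℤ         ≈⟨ *-comm _ _ ⟩
    # 1ℤ * # 1ℤ ^ 3         ∎
  norm-poch (suc m) = begin
    norm (p * x₁ * x₂ * x₃) * V (poch m * y)
      ≈⟨ *-cong (trans (norm-* (p * x₁ * x₂) x₃) (*-cong (trans (norm-* (p * x₁) x₂) (*-cong (trans (norm-* p x₁)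
           (*-congˡ (norm-1+3* m))) (norm-2+3* m))) (trans (norm-cong (sym (V-1-q^ (suc m)))) (norm-V y))))
           (trans (V-* (poch m) y) (*-congˡ (V-1-q^ (suc m)))) ⟩
    norm p * x₁ * x₂ * y ^ 3 * (V (poch m) * x₃)
      ≈⟨ solve 6 (λ n x₁ x₂ x₃ y v → n :* x₁ :* x₂ :* y :^ 3 :* (v :* x₃) := n :* v :* (x₁ :* x₂ :* x₃ :* y :^ 3))
           refl (norm p) x₁ x₂ x₃ y (V (poch m)) ⟩
    norm p * V (poch m) * (x₁ * x₂ * x₃ * y ^ 3)
      ≈⟨ *-congʳ (norm-poch m) ⟩
    p * poch m ^ 3 * (x₁ * x₂ * x₃ * y ^ 3)
      ≈⟨ solve 6 (λ p r x₁ x₂ x₃ y → p :* r :^ 3 :* (x₁ :* x₂ :* x₃ :* y :^ 3) := p :* x₁ :* x₂ :* x₃ :* (r :* y) :^ 3)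
           refl p (poch m) x₁ x₂ x₃ y ⟩
    p * x₁ * x₂ * x₃ * (poch m * y) ^ 3 ∎
    where
    p = poch (m ℕ.* 3)
    x₁ = # 1ℤ - q ^ (1 ℕ.+ m ℕ.* 3)
    x₂ = # 1ℤ - q ^ (2 ℕ.+ m ℕ.* 3)
    x₃ = # 1ℤ - q ^ (3 ℕ.+ m ℕ.* 3)
    y = # 1ℤ - q ^ suc m

  norm-φ : norm φ * V φ ≈ φ ^ 4
  norm-φ = upto⇒≈ λ n → ≤trans
    (*-cong≤ (norm-cong≤ (φ-upto {m = suc n ℕ.* 3} (ℕ.n≤1+n _))) (V-cong≤ (φ-upto (ℕ.n≤1+n n))))
    (≤trans (≈⇒upto (norm-poch (suc n)))
      (*-cong≤ (≤sym (φ-upto (ℕ.≤-trans (ℕ.n≤1+n n) (ℕ.m≤m*n (suc n) 3)))) (^-cong≤ 3 (≤sym (φ-upto (ℕ.n≤1+n n))))))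

  -- `N` is the norm of φ³, and `M` its inverse, written down in advance from the value φ¹² / `B`
  -- that `N` turns out to have. `D` is the cofactor (a³ - s³) / (a - s).
  A B N M a s D : ℤ⟦q⟧
  A = U 0 (φ ^ 3)
  B = V (φ ^ 3)
  N = A ^ 3 - # (+ 27) * q * B ^ 3
  M = φ⁻¹ ^ 12 * B
  a = V A
  s = # (+ 3) * (q * V B)
  D = a ^ 2 + a * s + s ^ 2

  φ³≈a-s : φ ^ 3 ≈ a - s
  φ³≈a-s = begin
    φ ^ 3
      ≈⟨ decompose (φ ^ 3) ⟩
    a + q * (V (U 1 (φ ^ 3)) + q * V (U 2 (φ ^ 3)))
      ≈⟨ +-congˡ (*-congˡ (+-cong
           (trans (V-cong U1-φ³) (trans (V-* _ _) (*-congʳ (V-# _))))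
           (*-congˡ (trans (V-cong U2-φ³) (V-# 0ℤ))))) ⟩
    a + q * (# (ℤ.- (+ 3)) * V B + q * # 0ℤ)
      ≈⟨ solve 3 (λ q a b → a :+ q :* (con (ℤ.- (+ 3)) :* b :+ q :* con 0ℤ) := a :- con (+ 3) :* (q :* b)) refl q a (V B) ⟩
    a - s ∎

  norm-φ³ : norm (φ ^ 3) ≈ N
  norm-φ³ = trans (cubic-cong refl U1-φ³ U2-φ³)
    (solve 3 (λ q a b → a :^ 3 :+ q :* (con (ℤ.- (+ 3)) :* b) :^ 3 :+ q :^ 2 :* con 0ℤ :^ 3
      :- con (+ 3) :* q :* (a :* (con (ℤ.- (+ 3)) :* b) :* con 0ℤ)
      := a :^ 3 :- con (+ 27) :* q :* b :^ 3) refl q A B)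

  N*B≈φ¹² : N * B ≈ φ ^ 12
  N*B≈φ¹² = begin
    N * V (φ ^ 3)
      ≈⟨ *-cong (sym norm-φ³) (V-^ φ 3) ⟩
    norm (φ ^ 3) * V φ ^ 3
      ≈⟨ *-congʳ (trans (norm-cong (solve 1 (λ x → x :^ 3 := x :* (x :* x)) refl φ))
           (trans (norm-* φ (φ * φ)) (*-congˡ (norm-* φ φ)))) ⟩
    norm φ * (norm φ * norm φ) * V φ ^ 3
      ≈⟨ solve 2 (λ n v → n :* (n :* n) :* v :^ 3 := (n :* v) :^ 3) refl (norm φ) (V φ) ⟩
    (norm φ * V φ) ^ 3
      ≈⟨ ^-congˡ 3 norm-φ ⟩
    (φ ^ 4) ^ 3
      ≈⟨ ^-assocʳ φ 4 3 ⟩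
    φ ^ 12 ∎

  φ⁻¹^*φ^≈1 : ∀ n → φ⁻¹ ^ n * φ ^ n ≈ # 1ℤ
  φ⁻¹^*φ^≈1 n = trans (sym (^-distrib-* φ⁻¹ φ n)) (trans (^-congˡ n φ⁻¹*φ≈1) (1^ n))
    where
    1^ : ∀ n → # 1ℤ ^ n ≈ # 1ℤ
    1^ zero    = refl
    1^ (suc n) = trans (*-identityˡ _) (1^ n)

  M*N≈1 : M * N ≈ # 1ℤ
  M*N≈1 = begin
    φ⁻¹ ^ 12 * B * N    ≈⟨ *-assoc (φ⁻¹ ^ 12) B N ⟩
    φ⁻¹ ^ 12 * (B * N)  ≈⟨ *-congˡ (trans (*-comm B N) N*B≈φ¹²) ⟩
    φ⁻¹ ^ 12 * φ ^ 12   ≈⟨ φ⁻¹^*φ^≈1 12 ⟩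
    # 1ℤ                ∎

  s³≈ : s ^ 3 ≈ V (# (+ 27) * q * B ^ 3)
  s³≈ = sym (begin
    V (# (+ 27) * q * B ^ 3)        ≈⟨ trans (V-* _ _) (*-cong (trans (V-* _ _) (*-cong (V-# _) V-q)) (V-^ B 3)) ⟩
    # (+ 27) * q ^ 3 * V B ^ 3      ≈⟨ solve 2 (λ q b → con (+ 27) :* q :^ 3 :* b :^ 3 := (con (+ 3) :* (q :* b)) :^ 3) refl q (V B) ⟩
    s ^ 3                           ∎)

  φ³*D≈VN : φ ^ 3 * D ≈ V N
  φ³*D≈VN = begin
    φ ^ 3 * D           ≈⟨ *-congʳ φ³≈a-s ⟩
    (a - s) * D         ≈⟨ solve 2 (λ a s → (a :- s) :* (a :^ 2 :+ a :* s :+ s :^ 2) := a :^ 3 :- s :^ 3) refl a s ⟩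
    a ^ 3 - s ^ 3       ≈⟨ +-cong (sym (V-^ A 3)) (-‿cong s³≈) ⟩
    V (A ^ 3) - V (# (+ 27) * q * B ^ 3)  ≈⟨ trans (V-+ _ _) (+-congˡ (V-neg _)) ⟨
    V N                 ∎

  φ⁻³ : φ⁻¹ ^ 3 ≈ D * V M
  φ⁻³ = begin
    φ⁻¹ ^ 3                            ≈⟨ *-identityʳ _ ⟨
    φ⁻¹ ^ 3 * # 1ℤ                     ≈⟨ *-congˡ (trans (sym (V-* M N)) (trans (V-cong M*N≈1) (V-# 1ℤ))) ⟨
    φ⁻¹ ^ 3 * (V M * V N)              ≈⟨ *-congˡ (*-congˡ φ³*D≈VN) ⟨
    φ⁻¹ ^ 3 * (V M * (φ ^ 3 * D))      ≈⟨ solve 4 (λ i m f d → i :* (m :* (f :* d)) := i :* f :* (d :* m)) refl (φ⁻¹ ^ 3) (V M) (φ ^ 3) D ⟩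
    φ⁻¹ ^ 3 * φ ^ 3 * (D * V M)        ≈⟨ *-congʳ (φ⁻¹^*φ^≈1 3) ⟩
    # 1ℤ * (D * V M)                   ≈⟨ *-identityˡ _ ⟩
    D * V M                            ∎

-- Degree arithmetic modulo 3.

module Arithmetic where

  open import Data.Nat.Base using (ℕ; _+_; _*_)
  import Data.Nat.Properties as ℕ
  open import Data.Nat.Divisibility using (divides; ∣m+n∣m⇒∣n; n∣m*n)
  open import Data.Nat.Solver using (module +-*-Solver)
  open import Data.Product using (∃-syntax; _×_; _,_)
  open import Relation.Binary.PropositionalEquality
  open +-*-Solver

  +-shift-3 : ∀ m d → m + (3 + d) ≡ 3 + (m + d)
  +-shift-3 = solve 2 (λ m d → m :+ (con 3 :+ d) := con 3 :+ (m :+ d)) refl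

  private
    degree-total : ∀ {c d r} i k → d + r ≡ 6 → r + i * 3 + k + d ≡ c * 3 → k + (i + 2) * 3 ≡ c * 3
    degree-total {c} {d} {r} i k d+r≡6 eq = begin
      k + (i + 2) * 3      ≡⟨ solve 2 (λ k i → k :+ (i :+ con 2) :* con 3 := i :* con 3 :+ k :+ con 6) refl k i ⟩
      i * 3 + k + 6        ≡⟨ cong (i * 3 + k +_) d+r≡6 ⟨
      i * 3 + k + (d + r)  ≡⟨ solve 4 (λ i k d r → i :+ k :+ (d :+ r) := r :+ i :+ k :+ d) refl (i * 3) k d r ⟩
      r + i * 3 + k + d    ≡⟨ eq ⟩
      c * 3                ∎
      where open ≡-Reasoning

  -- Once d + r = 6, every other term of the degree equation is a multiple of 3, hence so is k. The
  -- summand 2 = 6 / 3 is the power of `M` left over in `form-section`.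
  split-degree : ∀ {c d r} i k → d + r ≡ 6 → r + i * 3 + k + d ≡ c * 3 → ∃[ l ] k ≡ l * 3 × c ≡ l + (i + 2)
  split-degree {c} {d} {r} i k d+r≡6 eq
    with total ← degree-total {c} {d} {r} i k d+r≡6 eq
    with divides l k≡l*3 ← ∣m+n∣m⇒∣n (divides c (trans (ℕ.+-comm ((i + 2) * 3) k) total)) (n∣m*n (i + 2)) =
    l , k≡l*3 , ℕ.*-cancelʳ-≡ c (l + (i + 2)) 3 (trans (sym total)
      (trans (cong (_+ (i + 2) * 3) k≡l*3) (sym (ℕ.*-distribʳ-+ 3 l (i + 2)))))

-- Polynomials in `T`, homogeneous forms in a and s, and their sections.

module Forms where

  open import Data.Integer.Base using (+_; 0ℤ; 1ℤ)
  open import Data.Fin.Base using (zero; suc; toℕ)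
  open import Data.Fin.Properties using (toℕ<n)
  open import Data.Nat.Base as ℕ using (ℕ; zero; suc; _<_)
  import Data.Nat.Properties as ℕ
  open import Data.Nat.DivMod using (DivMod; result; _divMod_)
  open import Data.Product using (∃-syntax; _×_; _,_)
  open import Relation.Binary.PropositionalEquality as ≡ using (_≡_; _≢_)
  import Relation.Binary.Reasoning.Setoid as ≈-Reasoning
  open import Relation.Nullary.Decidable using (yes; no)
  open Arithmetic
  open PowerSeries
  open Dissection
  open EulerProduct
  open CubicNorm
  open ≈-Reasoning setoid

  T X Y : ℤ⟦q⟧
  T = # (+ 27) * q * B ^ 3 * M
  X = B ^ 2 * φ⁻¹ ^ 12
  Y = B ^ 4 * φ⁻¹ ^ 18

  -- Applying `V`, the quotients of a³ and s³ by a³ - s³ are the images of 1 + T and T, which is the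
  -- origin of `T`.
  A³*M≈1+T : A ^ 3 * M ≈ # 1ℤ + T
  A³*M≈1+T = begin
    A ^ 3 * M    ≈⟨ solve 4 (λ a m b q → a :^ 3 :* m := m :* (a :^ 3 :- con (+ 27) :* q :* b :^ 3) :+ con (+ 27) :* q :* b :^ 3 :* m) refl A M B q ⟩
    M * N + T    ≈⟨ +-congʳ M*N≈1 ⟩
    # 1ℤ + T     ∎

  -- `T` is 27 q B⁴ φ⁻¹². Here φ⁻¹² is `(D * V M) ^ 4`, and B⁴ is φ¹² at q³, that is `V B * V N`;
  -- then 3 q `V B` is s, which leaves the factor 9, and `V N` cancels one `V M`.
  T≈9s : T ≈ # (+ 9) * (s * (D ^ 4 * V M ^ 3))
  T≈9s = begin
    # (+ 27) * q * B ^ 3 * (φ⁻¹ ^ 12 * B)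
      ≈⟨ solve 3 (λ q b i → con (+ 27) :* q :* b :^ 3 :* (i :* b) := con (+ 27) :* q :* i :* b :^ 4) refl q B (φ⁻¹ ^ 12) ⟩
    # (+ 27) * q * φ⁻¹ ^ 12 * B ^ 4
      ≈⟨ *-congˡ (trans (sym (V-^ (φ ^ 3) 4)) (V-cong (trans (^-assocʳ φ 3 4) (trans (sym N*B≈φ¹²) (*-comm N B))))) ⟩
    # (+ 27) * q * φ⁻¹ ^ 12 * V (B * N)
      ≈⟨ *-cong (*-congˡ (trans (sym (^-assocʳ φ⁻¹ 3 4)) (^-congˡ 4 φ⁻³))) (V-* B N) ⟩
    # (+ 27) * q * (D * V M) ^ 4 * (V B * V N)
      ≈⟨ solve 5 (λ q d m b n → con (+ 27) :* q :* (d :* m) :^ 4 :* (b :* n)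
           := con (+ 9) :* (con (+ 3) :* (q :* b) :* (d :^ 4 :* m :^ 3)) :* (m :* n)) refl q D (V M) (V B) (V N) ⟩
    # (+ 9) * (s * (D ^ 4 * V M ^ 3)) * (V M * V N)
      ≈⟨ trans (*-congˡ (trans (sym (V-* M N)) (trans (V-cong M*N≈1) (V-# 1ℤ)))) (*-identityʳ _) ⟩
    # (+ 9) * (s * (D ^ 4 * V M ^ 3)) ∎

  data ℤ[T] : ℤ⟦q⟧ → Set where
    one   : ℤ[T] (# 1ℤ)
    T*    : ∀ {f} → ℤ[T] f → ℤ[T] (T * f)
    add   : ∀ {f g} → ℤ[T] f → ℤ[T] g → ℤ[T] (f + g)
    scale : ∀ c {f} → ℤ[T] f → ℤ[T] (# c * f)
    resp  : ∀ {f g} → f ≈ g → ℤ[T] f → ℤ[T] g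

  T^* : ∀ n {f} → ℤ[T] f → ℤ[T] (T ^ n * f)
  T^* zero    p = resp (sym (*-identityˡ _)) p
  T^* (suc n) p = resp (sym (*-assoc T (T ^ n) _)) (T* (T^* n p))

  1+T^ : ∀ n → ℤ[T] ((# 1ℤ + T) ^ n)
  1+T^ zero    = one
  1+T^ (suc n) = resp (solve 2 (λ t f → f :+ t :* f := (con 1ℤ :+ t) :* f) refl T ((# 1ℤ + T) ^ n)) (add (1+T^ n) (T* (1+T^ n)))

  -- The ℤ-span of the monomials s^e a^k (V M)^c of degree −d, where s and a have degree 1
  -- and V M, the inverse of a³ − s³, has degree −3.
  data Form (d : ℕ) : ℤ⟦q⟧ → Set where
    mono  : ∀ e k c → e ℕ.+ k ℕ.+ d ≡ c ℕ.* 3 → Form d (s ^ e * (a ^ k * V M ^ c))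
    add   : ∀ {f g} → Form d f → Form d g → Form d (f + g)
    scale : ∀ c {f} → Form d f → Form d (# c * f)
    resp  : ∀ {f g} → f ≈ g → Form d f → Form d g

  private
    mapForm : ∀ {d d′} (x : ℤ⟦q⟧) → (∀ e k c → e ℕ.+ k ℕ.+ d ≡ c ℕ.* 3 → Form d′ (x * (s ^ e * (a ^ k * V M ^ c)))) →
              ∀ {f} → Form d f → Form d′ (x * f)
    mapForm x h (mono e k c p) = h e k c p
    mapForm x h (add {f} {g} p r) =
      resp (solve 3 (λ x f g → x :* f :+ x :* g := x :* (f :+ g)) refl x f g) (add (mapForm x h p) (mapForm x h r))
    mapForm x h (scale c {f} p) =
      resp (solve 3 (λ x c f → c :* (x :* f) := x :* (c :* f)) refl x (# c) f) (scale c (mapForm x h p))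
    mapForm x h (resp p r) = resp (*-congˡ p) (mapForm x h r)

    s* : ∀ {d f} → Form (1 ℕ.+ d) f → Form d (s * f)
    s* {d} = mapForm s λ e k c p → resp (*-assoc s (s ^ e) _)
      (mono (suc e) k c (≡.trans (≡.sym (ℕ.+-suc (e ℕ.+ k) d)) p))

    a* : ∀ {d f} → Form (1 ℕ.+ d) f → Form d (a * f)
    a* {d} = mapForm a λ e k c p →
      resp (solve 4 (λ a x y z → x :* (a :* y :* z) := a :* (x :* (y :* z))) refl a (s ^ e) (a ^ k) (V M ^ c))
      (mono e (suc k) c (≡.trans (≡.cong (ℕ._+ d) (ℕ.+-suc e k)) (≡.trans (≡.sym (ℕ.+-suc (e ℕ.+ k) d)) p)))

    VM* : ∀ {d f} → Form d f → Form (3 ℕ.+ d) (V M * f)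
    VM* {d} = mapForm (V M) λ e k c p →
      resp (solve 4 (λ m x y z → x :* (y :* (m :* z)) := m :* (x :* (y :* z))) refl (V M) (s ^ e) (a ^ k) (V M ^ c))
      (mono e k (suc c) (≡.trans (+-shift-3 (e ℕ.+ k) d) (≡.cong (3 ℕ.+_) p)))

    D* : ∀ {d f} → Form (2 ℕ.+ d) f → Form d (D * f)
    D* {f = f} p = resp (solve 3 (λ a s f → a :* (a :* f) :+ a :* (s :* f) :+ s :* (s :* f)
                             := (a :^ 2 :+ a :* s :+ s :^ 2) :* f) refl a s f)
      (add (add (a* (a* p)) (a* (s* p))) (s* (s* p)))

    DVM* : ∀ {d f} → Form d f → Form (1 ℕ.+ d) (D * V M * f)
    DVM* p = resp (sym (*-assoc D (V M) _)) (D* (VM* p))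

    DVM^ : ∀ n → Form n ((D * V M) ^ n)
    DVM^ zero    = resp (solve 0 (con 1ℤ :* (con 1ℤ :* con 1ℤ) := con 1ℤ) refl) (mono 0 0 0 ≡.refl)
    DVM^ (suc n) = DVM* (DVM^ n)

  φ⁻³^-form : ∀ n → Form n (φ⁻¹ ^ (3 ℕ.* n))
  φ⁻³^-form n = resp (trans (sym (^-congˡ n φ⁻³)) (^-assocʳ φ⁻¹ 3 n)) (DVM^ n)

  -- The degrees balance: s contributes 1, `D ^ 4` contributes 8 and `V M ^ 3` contributes -9. The
  -- factor 9 is kept outside because the divisibility of the sections of `Y` depends on it.
  T*-form : ∀ {d f} → Form d f → ∃[ g ] Form d g × T * f ≈ # (+ 9) * g
  T*-form {d} {f} p = _ , s* (D* (D* (D* (D* (VM* (VM* (VM* p))))))) , (begin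
    T * f
      ≈⟨ *-congʳ T≈9s ⟩
    # (+ 9) * (s * (D ^ 4 * V M ^ 3)) * f
      ≈⟨ solve 4 (λ s d m f → con (+ 9) :* (s :* (d :^ 4 :* m :^ 3)) :* f
           := con (+ 9) :* (s :* (d :* (d :* (d :* (d :* (m :* (m :* (m :* f))))))))) refl s D (V M) f ⟩
    # (+ 9) * (s * (D * (D * (D * (D * (V M * (V M * (V M * f)))))))) ∎)

  ℤ[T]*form : ∀ {d p f} → ℤ[T] p → Form d f → Form d (p * f)
  ℤ[T]*form one u = resp (sym (*-identityˡ _)) u
  ℤ[T]*form (T* {p} x) u =
    let _ , v , eq = T*-form (ℤ[T]*form x u)
    in resp (trans (sym eq) (sym (*-assoc T p _))) (scale (+ 9) v)
  ℤ[T]*form {f = f} (add {g} {h} x y) u =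
    resp (solve 3 (λ g h f → g :* f :+ h :* f := (g :+ h) :* f) refl g h f) (add (ℤ[T]*form x u) (ℤ[T]*form y u))
  ℤ[T]*form (scale c {g} x) u = resp (sym (*-assoc (# c) g _)) (scale c (ℤ[T]*form x u))
  ℤ[T]*form (resp e x) u = resp (*-congʳ e) (ℤ[T]*form x u)

  ^*3 : ∀ x i → x ^ (i ℕ.* 3) ≈ (x ^ 3) ^ i
  ^*3 x i = trans (reflexive (≡.cong (x ^_) (ℕ.*-comm i 3))) (sym (^-assocʳ x 3 i))

  3B : ℤ⟦q⟧
  3B = # (+ 3) * B

  -- As s is q times a series in q³, the exponent of s modulo 3 alone decides the residue class of
  -- the monomial.
  s^*V : ∀ r i h → s ^ (r ℕ.+ i ℕ.* 3) * V h ≈ q ^ r * V (q ^ i * 3B ^ (r ℕ.+ i ℕ.* 3) * h)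
  s^*V r i h = begin
    s ^ e * V h
      ≈⟨ *-congʳ (^-congˡ e (trans (solve 2 (λ q b → con (+ 3) :* (q :* b) := q :* (con (+ 3) :* b)) refl q (V B))
           (*-congˡ (sym (trans (V-* _ B) (*-congʳ (V-# _))))))) ⟩
    (q * V 3B) ^ e * V h
      ≈⟨ *-congʳ (trans (^-distrib-* q (V 3B) e) (*-cong (^-homo-* q r (i ℕ.* 3)) (sym (V-^ 3B e)))) ⟩
    q ^ r * q ^ (i ℕ.* 3) * V (3B ^ e) * V h
      ≈⟨ solve 4 (λ x y z h → x :* y :* z :* h := x :* (y :* z :* h)) refl (q ^ r) (q ^ (i ℕ.* 3)) (V (3B ^ e)) (V h) ⟩
    q ^ r * (q ^ (i ℕ.* 3) * V (3B ^ e) * V h)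
      ≈⟨ *-congˡ (trans (V-* _ h) (*-congʳ (trans (V-* _ _) (*-congʳ (sym (q^*3 i)))))) ⟨
    q ^ r * V (q ^ i * 3B ^ e * h) ∎
    where
    e : ℕ
    e = r ℕ.+ i ℕ.* 3

  V-mono : ∀ k c → a ^ k * V M ^ c ≈ V (A ^ k * M ^ c)
  V-mono k c = sym (trans (V-* _ _) (*-cong (V-^ A k) (V-^ M c)))

  U-s^-diag : ∀ r i h → U r (s ^ (r ℕ.+ i ℕ.* 3) * V h) ≈ q ^ i * 3B ^ (r ℕ.+ i ℕ.* 3) * h
  U-s^-diag r i h = trans (U-cong r (s^*V r i h)) (U-q^V-diag r _)

  U-s^-off : ∀ {r t} i h → r < 3 → t < 3 → r ≢ t → U r (s ^ (t ℕ.+ i ℕ.* 3) * V h) ≈ # 0ℤ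
  U-s^-off {r} {t} i h r<3 t<3 r≢t = trans (U-cong r (s^*V t i h)) (U-q^V-off _ r<3 t<3 r≢t)

  infix 4 _∣ˢ_
  _∣ˢ_ : ℤ⟦q⟧ → ℤ⟦q⟧ → Set
  c ∣ˢ f = ∃[ h ] f ≈ c * h

  ∣ˢ-resp : ∀ {c f g} → f ≈ g → c ∣ˢ f → c ∣ˢ g
  ∣ˢ-resp f≈g (h , p) = h , trans (sym f≈g) p

  ∣ˢ-+ : ∀ {c f g} → c ∣ˢ f → c ∣ˢ g → c ∣ˢ f + g
  ∣ˢ-+ {c} (h , p) (k , r) =
    h + k , trans (+-cong p r) (solve 3 (λ c h k → c :* h :+ c :* k := c :* (h :+ k)) refl c h k)

  ∣ˢ-* : ∀ {c f} x → c ∣ˢ f → c ∣ˢ x * f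
  ∣ˢ-* {c} x (h , p) = x * h , trans (*-congˡ p) (solve 3 (λ c x h → x :* (c :* h) := c :* (x :* h)) refl c x h)

  ∣ˢ-0 : ∀ {c} → c ∣ˢ # 0ℤ
  ∣ˢ-0 {c} = # 0ℤ , sym (zeroʳ c)

  -- A monomial that survives in `U r` has s-exponent r + 3i, and each s carries a factor 3.
  form-divisible : ∀ {d f r} → r < 3 → Form d f → # (+ 3) ^ r ∣ˢ U r f
  form-divisible {r = r} r<3 (mono e k c _) = lemma e (e divMod 3)
    where
    m = a ^ k * V M ^ c
    h = A ^ k * M ^ c
    lemma : ∀ e → DivMod e 3 → # (+ 3) ^ r ∣ˢ U r (s ^ e * m)
    lemma _ (result i t ≡.refl) with r ℕ.≟ toℕ t
    ... | yes ≡.refl = q ^ i * (B ^ r * 3B ^ (i ℕ.* 3)) * h , (begin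
      U r (s ^ (r ℕ.+ i ℕ.* 3) * m)
        ≈⟨ trans (U-cong r (*-congˡ (V-mono k c))) (U-s^-diag r i h) ⟩
      q ^ i * 3B ^ (r ℕ.+ i ℕ.* 3) * h
        ≈⟨ *-congʳ (*-congˡ (trans (^-homo-* 3B r (i ℕ.* 3)) (*-congʳ (^-distrib-* (# (+ 3)) B r)))) ⟩
      q ^ i * (# (+ 3) ^ r * B ^ r * 3B ^ (i ℕ.* 3)) * h
        ≈⟨ solve 5 (λ x y z w h → x :* (y :* z :* w) :* h := y :* (x :* (z :* w) :* h)) refl (q ^ i) (# (+ 3) ^ r) (B ^ r) (3B ^ (i ℕ.* 3)) h ⟩
      # (+ 3) ^ r * (q ^ i * (B ^ r * 3B ^ (i ℕ.* 3)) * h) ∎)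
    ... | no r≢t = ∣ˢ-resp (sym (trans (U-cong r (*-congˡ (V-mono k c))) (U-s^-off i h r<3 (toℕ<n t) r≢t))) ∣ˢ-0
  form-divisible {r = r} r<3 (add x y) = ∣ˢ-resp (sym (U-+ r _ _)) (∣ˢ-+ (form-divisible r<3 x) (form-divisible r<3 y))
  form-divisible {r = r} r<3 (scale c x) = ∣ˢ-resp (sym (U-#* r c _)) (∣ˢ-* (# c) (form-divisible r<3 x))
  form-divisible {r = r} r<3 (resp p x) = ∣ˢ-resp (U-cong r p) (form-divisible r<3 x)

  -- In a surviving monomial the condition d + r = 6 makes the exponent of a divisible by 3. Apart
  -- from `3B ^ r` and two copies of `M`, everything then groups into 27 q B³ M = T and A³ M = 1 +
  -- T.
  form-section : ∀ {d f r} → r < 3 → d ℕ.+ r ≡ 6 → Form d f → ∃[ p ] ℤ[T] p × U r f ≈ 3B ^ r * M ^ 2 * p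
  form-section {d} {r = r} r<3 d+r≡6 (mono e k c eq) = lemma e eq (e divMod 3)
    where
    m = a ^ k * V M ^ c
    lemma : ∀ e → e ℕ.+ k ℕ.+ d ≡ c ℕ.* 3 → DivMod e 3 → ∃[ p ] ℤ[T] p × U r (s ^ e * m) ≈ 3B ^ r * M ^ 2 * p
    lemma _ eq (result i t ≡.refl) with r ℕ.≟ toℕ t
    ... | no r≢t = # 0ℤ , resp (zeroˡ _) (scale 0ℤ one) ,
      trans (U-cong r (*-congˡ (V-mono k c))) (trans (U-s^-off i _ r<3 (toℕ<n t) r≢t) (sym (zeroʳ _)))
    -- s^(3i) accounts for `T ^ i` and a^(3l) for `(1 + T) ^ l`, each using up as many copies of
    -- `M`.
    ... | yes ≡.refl with l , k≡l*3 , c≡ ← split-degree {c} {d} {r} i k d+r≡6 eq = T ^ i * (# 1ℤ + T) ^ l , T^* i (1+T^ l) , (begin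
      U r (s ^ (r ℕ.+ i ℕ.* 3) * m)
        ≈⟨ trans (U-cong r (*-congˡ (V-mono k c))) (U-s^-diag r i _) ⟩
      q ^ i * 3B ^ (r ℕ.+ i ℕ.* 3) * (A ^ k * M ^ c)
        ≈⟨ *-cong (*-congˡ (trans (^-homo-* 3B r (i ℕ.* 3)) (*-congˡ (^*3 3B i))))
             (*-cong (trans (reflexive (≡.cong (A ^_) k≡l*3)) (^*3 A l))
               (trans (reflexive (≡.cong (M ^_) c≡)) (trans (^-homo-* M l (i ℕ.+ 2)) (*-congˡ (^-homo-* M i 2))))) ⟩
      q ^ i * (3B ^ r * (3B ^ 3) ^ i) * ((A ^ 3) ^ l * (M ^ l * (M ^ i * M ^ 2)))
        ≈⟨ solve 7 (λ x y z u v w o → x :* (y :* z) :* (u :* (v :* (w :* o))) := y :* o :* (x :* z :* w :* (u :* v)))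
             refl (q ^ i) (3B ^ r) ((3B ^ 3) ^ i) ((A ^ 3) ^ l) (M ^ l) (M ^ i) (M ^ 2) ⟩
      3B ^ r * M ^ 2 * (q ^ i * (3B ^ 3) ^ i * M ^ i * ((A ^ 3) ^ l * M ^ l))
        ≈⟨ *-congˡ (*-cong
             (trans (*-congʳ (sym (^-distrib-* q _ i))) (trans (sym (^-distrib-* _ M i)) (^-congˡ i
               (solve 3 (λ q b m → q :* (con (+ 3) :* b) :^ 3 :* m := con (+ 27) :* q :* b :^ 3 :* m) refl q B M))))
             (trans (sym (^-distrib-* (A ^ 3) M l)) (^-congˡ l A³*M≈1+T))) ⟩
      3B ^ r * M ^ 2 * (T ^ i * (# 1ℤ + T) ^ l) ∎)
  form-section {r = r} r<3 eq (add x y) =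
    let p , px , ex = form-section r<3 eq x
        p′ , py , ey = form-section r<3 eq y
    in p + p′ , add px py , trans (U-+ r _ _) (trans (+-cong ex ey)
         (solve 3 (λ c x y → c :* x :+ c :* y := c :* (x :+ y)) refl (3B ^ r * M ^ 2) p p′))
  form-section {r = r} r<3 eq (scale c x) =
    let p , px , ex = form-section r<3 eq x
    in # c * p , scale c px , trans (U-#* r c _) (trans (*-congˡ ex)
         (solve 3 (λ u c x → c :* (u :* x) := u :* (c :* x)) refl (3B ^ r * M ^ 2) (# c) p))
  form-section {r = r} r<3 eq (resp e x) =
    let p , px , ex = form-section r<3 eq x
    in p , px , trans (U-cong r (sym e)) ex

-- The sections of `X` ℤ[T] and `Y` ℤ[T], and the first section of the generating function.

module Sections where

  open import Data.Integer.Base using (+_; 0ℤ; 1ℤ)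
  open import Data.Nat.Base using (_<_; z≤n; s≤s)
  open import Data.Product using (∃-syntax; _×_; _,_)
  open import Relation.Binary.PropositionalEquality as ≡ using (_≡_)
  import Relation.Binary.Reasoning.Setoid as ≈-Reasoning
  open PowerSeries
  open Dissection
  open EulerProduct
  open CubicNorm
  open Forms
  open ≈-Reasoning setoid

  private
    0<3 : 0 < 3
    0<3 = s≤s z≤n
    1<3 : 1 < 3
    1<3 = s≤s (s≤s z≤n)
    2<3 : 2 < 3
    2<3 = s≤s (s≤s (s≤s z≤n))

    -- `B` is φ³ at q³, so its powers leave a section as powers of φ³, and only the form
    -- `p * φ⁻¹ ^ 12` has to be sectioned.
    X*-V : ∀ p → X * p ≈ V ((φ ^ 3) ^ 2) * (p * φ⁻¹ ^ 12)
    X*-V p = trans (solve 3 (λ b i p → b :* i :* p := b :* (p :* i)) refl (B ^ 2) (φ⁻¹ ^ 12) p)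
      (*-congʳ (sym (V-^ (φ ^ 3) 2)))

    Y*-V : ∀ p → Y * p ≈ V ((φ ^ 3) ^ 4) * (p * φ⁻¹ ^ 18)
    Y*-V p = trans (solve 3 (λ b i p → b :* i :* p := b :* (p :* i)) refl (B ^ 4) (φ⁻¹ ^ 18) p)
      (*-congʳ (sym (V-^ (φ ^ 3) 4)))

    cancel-φ : ∀ x → x * (φ⁻¹ * φ) ^ 6 ≈ x
    cancel-φ x = trans (*-congˡ (trans (^-distrib-* φ⁻¹ φ 6) (φ⁻¹^*φ^≈1 6))) (*-identityʳ x)

  -- φ⁻¹² has degree -4, and 4 + 2 = 6. The outer factors combine to φ⁶ · 9B² · B² φ⁻²⁴ = 9Y.
  U2-X : ∀ {p} → ℤ[T] p → ∃[ p′ ] ℤ[T] p′ × U 2 (X * p) ≈ # (+ 9) * (Y * p′)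
  U2-X {p} x =
    let p′ , x′ , eq = form-section {r = 2} 2<3 ≡.refl (ℤ[T]*form x (φ⁻³^-form 4))
    in p′ , x′ , (begin
      U 2 (X * p)
        ≈⟨ trans (U-cong 2 (X*-V p)) (U-V* ((φ ^ 3) ^ 2) _ 2<3) ⟩
      (φ ^ 3) ^ 2 * U 2 (p * φ⁻¹ ^ 12)
        ≈⟨ *-congˡ eq ⟩
      (φ ^ 3) ^ 2 * ((# (+ 3) * B) ^ 2 * (φ⁻¹ ^ 12 * B) ^ 2 * p′)
        ≈⟨ solve 4 (λ f i b p → (f :^ 3) :^ 2 :* ((con (+ 3) :* b) :^ 2 :* (i :^ 12 :* b) :^ 2 :* p)
             := con (+ 9) :* (b :^ 4 :* i :^ 18 :* p) :* (i :* f) :^ 6) refl φ φ⁻¹ B p′ ⟩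
      # (+ 9) * (Y * p′) * (φ⁻¹ * φ) ^ 6
        ≈⟨ cancel-φ _ ⟩
      # (+ 9) * (Y * p′) ∎)

  -- φ⁻¹⁸ has degree -6, and 6 + 0 = 6. The outer factors combine to φ¹² · B² φ⁻²⁴ = X; with r = 0
  -- no power of 3 is gained.
  U0-Y : ∀ {p} → ℤ[T] p → ∃[ p′ ] ℤ[T] p′ × U 0 (Y * p) ≈ X * p′
  U0-Y {p} x =
    let p′ , x′ , eq = form-section {r = 0} 0<3 ≡.refl (ℤ[T]*form x (φ⁻³^-form 6))
    in p′ , x′ , (begin
      U 0 (Y * p)
        ≈⟨ trans (U-cong 0 (Y*-V p)) (U-V* ((φ ^ 3) ^ 4) _ 0<3) ⟩
      (φ ^ 3) ^ 4 * U 0 (p * φ⁻¹ ^ 18)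
        ≈⟨ *-congˡ eq ⟩
      (φ ^ 3) ^ 4 * (# 1ℤ * (φ⁻¹ ^ 12 * B) ^ 2 * p′)
        ≈⟨ solve 4 (λ f i b p → (f :^ 3) :^ 4 :* (con 1ℤ :* (i :^ 12 :* b) :^ 2 :* p)
             := b :^ 2 :* i :^ 12 :* p :* (i :* f) :^ 6 :* (i :* f) :^ 6) refl φ φ⁻¹ B p′ ⟩
      X * p′ * (φ⁻¹ * φ) ^ 6 * (φ⁻¹ * φ) ^ 6
        ≈⟨ trans (cancel-φ _) (cancel-φ _) ⟩
      X * p′ ∎)

  U1-X : ∀ {p} → ℤ[T] p → # (+ 3) ∣ˢ U 1 (X * p)
  U1-X {p} x =
    let h , eq = form-divisible 1<3 (ℤ[T]*form x (φ⁻³^-form 4))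
    in ∣ˢ-resp (sym (trans (U-cong 1 (X*-V p)) (U-V* ((φ ^ 3) ^ 2) _ 1<3)))
         (∣ˢ-* ((φ ^ 3) ^ 2) (h , trans eq (*-congʳ (*-identityʳ _))))

  private
    -- The numbers are the coefficients of (a² + as + s²)⁶. Both 6 and 21 are multiples of 3, and
    -- from s³ on the power of s itself supplies 27, so the remaining terms are collected in `g`.
    φ⁻¹⁸-expansion : ∃[ g ] φ⁻¹ ^ 18 ≈
      V (A ^ 12 * M ^ 6) + # (+ 6) * (s ^ 1 * V (A ^ 11 * M ^ 6)) + # (+ 21) * (s ^ 2 * V (A ^ 10 * M ^ 6)) + V (# (+ 27) * (q * B ^ 3)) * g
    φ⁻¹⁸-expansion = _ , (begin
      φ⁻¹ ^ 18
        ≈⟨ trans (sym (^-assocʳ φ⁻¹ 3 6)) (^-congˡ 6 φ⁻³) ⟩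
      (D * V M) ^ 6
        ≈⟨ solve 3 (λ a s m → ((a :^ 2 :+ a :* s :+ s :^ 2) :* m) :^ 6 :=
             con 1ℤ :* (a :^ 12 :* m :^ 6) :+ con (+ 6) :* (s :^ 1 :* (a :^ 11 :* m :^ 6)) :+ con (+ 21) :* (s :^ 2 :* (a :^ 10 :* m :^ 6))
             :+ s :^ 3 :* (m :^ 6 :* (con (+ 50) :* a :^ 9 :+ con (+ 90) :* a :^ 8 :* s :+ con (+ 126) :* a :^ 7 :* s :^ 2
               :+ con (+ 141) :* a :^ 6 :* s :^ 3 :+ con (+ 126) :* a :^ 5 :* s :^ 4 :+ con (+ 90) :* a :^ 4 :* s :^ 5
               :+ con (+ 50) :* a :^ 3 :* s :^ 6 :+ con (+ 21) :* a :^ 2 :* s :^ 7 :+ con (+ 6) :* a :* s :^ 8 :+ s :^ 9)))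
             refl a s (V M) ⟩
      # 1ℤ * (a ^ 12 * V M ^ 6) + # (+ 6) * (s ^ 1 * (a ^ 11 * V M ^ 6)) + # (+ 21) * (s ^ 2 * (a ^ 10 * V M ^ 6)) + s ^ 3 * g
        ≈⟨ +-cong (+-cong (+-cong (trans (*-identityˡ _) (V-mono 12 6)) (*-congˡ (*-congˡ (V-mono 11 6))))
             (*-congˡ (*-congˡ (V-mono 10 6)))) (*-congʳ (trans s³≈ (V-cong (*-assoc _ q (B ^ 3))))) ⟩
      V (A ^ 12 * M ^ 6) + # (+ 6) * (s ^ 1 * V (A ^ 11 * M ^ 6)) + # (+ 21) * (s ^ 2 * V (A ^ 10 * M ^ 6)) + V (# (+ 27) * (q * B ^ 3)) * g ∎)
      where
      g = V M ^ 6 * (# (+ 50) * a ^ 9 + # (+ 90) * a ^ 8 * s + # (+ 126) * a ^ 7 * s ^ 2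
        + # (+ 141) * a ^ 6 * s ^ 3 + # (+ 126) * a ^ 5 * s ^ 4 + # (+ 90) * a ^ 4 * s ^ 5
        + # (+ 50) * a ^ 3 * s ^ 6 + # (+ 21) * a ^ 2 * s ^ 7 + # (+ 6) * a * s ^ 8 + s ^ 9)

    U-expansion : ∀ {r u v w g} → r < 3 → let f = V u + # (+ 6) * (s ^ 1 * V v) + # (+ 21) * (s ^ 2 * V w) + V (# (+ 27) * (q * B ^ 3)) * g in
      U r f ≈ U r (V u) + # (+ 6) * U r (s ^ 1 * V v) + # (+ 21) * U r (s ^ 2 * V w) + # (+ 27) * (q * B ^ 3) * U r g
    U-expansion {r} {g = g} r<3 = trans (U-+ r _ _) (+-cong (trans (U-+ r _ _) (+-cong (trans (U-+ r _ _)
      (+-congˡ (U-#* r _ _))) (U-#* r _ _))) (U-V* _ g r<3))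

  U1-φ⁻¹⁸ : # (+ 9) ∣ˢ U 1 (φ⁻¹ ^ 18)
  U1-φ⁻¹⁸ =
    let g , eq = φ⁻¹⁸-expansion
    in _ , (begin
      U 1 (φ⁻¹ ^ 18)
        ≈⟨ trans (U-cong 1 eq) (U-expansion 1<3) ⟩
      U 1 (V (A ^ 12 * M ^ 6)) + # (+ 6) * U 1 (s ^ 1 * V (A ^ 11 * M ^ 6))
        + # (+ 21) * U 1 (s ^ 2 * V (A ^ 10 * M ^ 6)) + # (+ 27) * (q * B ^ 3) * U 1 g
        ≈⟨ +-congʳ (+-cong (+-cong (U1-V _) (*-congˡ (U-s^-diag 1 0 _))) (*-congˡ (U-s^-off 0 _ 1<3 2<3 λ ()))) ⟩
      # 0ℤ + # (+ 6) * (# 1ℤ * (# (+ 3) * B) ^ 1 * (A ^ 11 * M ^ 6)) + # (+ 21) * # 0ℤ + # (+ 27) * (q * B ^ 3) * U 1 g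
        ≈⟨ solve 4 (λ b h y z → con 0ℤ :+ con (+ 6) :* (con 1ℤ :* (con (+ 3) :* b) :^ 1 :* h) :+ con (+ 21) :* con 0ℤ :+ con (+ 27) :* y :* z
             := con (+ 9) :* (con (+ 2) :* b :* h :+ con (+ 3) :* y :* z)) refl B (A ^ 11 * M ^ 6) (q * B ^ 3) (U 1 g) ⟩
      # (+ 9) * (# (+ 2) * B * (A ^ 11 * M ^ 6) + # (+ 3) * (q * B ^ 3) * U 1 g) ∎)

  -- Only the s² term survives besides the tail: 21 from the expansion times 3² from s² is 27 · 7.
  -- Likewise, in `U1-φ⁻¹⁸`, 6 · 3 = 9 · 2.
  U2-φ⁻¹⁸ : # (+ 27) ∣ˢ U 2 (φ⁻¹ ^ 18)
  U2-φ⁻¹⁸ =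
    let g , eq = φ⁻¹⁸-expansion
    in _ , (begin
      U 2 (φ⁻¹ ^ 18)
        ≈⟨ trans (U-cong 2 eq) (U-expansion 2<3) ⟩
      U 2 (V (A ^ 12 * M ^ 6)) + # (+ 6) * U 2 (s ^ 1 * V (A ^ 11 * M ^ 6))
        + # (+ 21) * U 2 (s ^ 2 * V (A ^ 10 * M ^ 6)) + # (+ 27) * (q * B ^ 3) * U 2 g
        ≈⟨ +-congʳ (+-cong (+-cong (U2-V _) (*-congˡ (U-s^-off 0 _ 2<3 1<3 λ ()))) (*-congˡ (U-s^-diag 2 0 _))) ⟩
      # 0ℤ + # (+ 6) * # 0ℤ + # (+ 21) * (# 1ℤ * (# (+ 3) * B) ^ 2 * (A ^ 10 * M ^ 6)) + # (+ 27) * (q * B ^ 3) * U 2 g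
        ≈⟨ solve 4 (λ b h y z → con 0ℤ :+ con (+ 6) :* con 0ℤ :+ con (+ 21) :* (con 1ℤ :* (con (+ 3) :* b) :^ 2 :* h) :+ con (+ 27) :* y :* z
             := con (+ 27) :* (con (+ 7) :* b :^ 2 :* h :+ y :* z)) refl B (A ^ 10 * M ^ 6) (q * B ^ 3) (U 2 g) ⟩
      # (+ 27) * (# (+ 7) * B ^ 2 * (A ^ 10 * M ^ 6) + q * B ^ 3 * U 2 g) ∎)

  private
    -- T is 9 times a form, which leaves room for the factor 3^r of form-divisible.
    U-ℤ[T]*φ⁻¹⁸ : ∀ {c r} → r < 3 → c ∣ˢ U r (φ⁻¹ ^ 18) → c ∣ˢ # (+ 9) * # (+ 3) ^ r →
                   ∀ {p} → ℤ[T] p → c ∣ˢ U r (p * φ⁻¹ ^ 18)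
    U-ℤ[T]*φ⁻¹⁸ {r = r} r<3 h₁ h₂ one = ∣ˢ-resp (U-cong r (sym (*-identityˡ _))) h₁
    U-ℤ[T]*φ⁻¹⁸ {c} {r} r<3 h₁ (w , h₂) (T* {p} x) =
      let g , form , eq = T*-form (ℤ[T]*form x (φ⁻³^-form 6))
          h , eq′ = form-divisible r<3 form
      in w * h , (begin
        U r (T * p * φ⁻¹ ^ 18)          ≈⟨ U-cong r (trans (*-assoc T p _) eq) ⟩
        U r (# (+ 9) * g)               ≈⟨ U-#* r _ g ⟩
        # (+ 9) * U r g                 ≈⟨ *-congˡ eq′ ⟩
        # (+ 9) * (# (+ 3) ^ r * h)     ≈⟨ *-assoc _ _ h ⟨
        # (+ 9) * # (+ 3) ^ r * h       ≈⟨ *-congʳ h₂ ⟩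
        c * w * h                       ≈⟨ *-assoc c w h ⟩
        c * (w * h)                     ∎)
    U-ℤ[T]*φ⁻¹⁸ {c} {r} r<3 h₁ h₂ (add {f} {g} x y) =
      ∣ˢ-resp (trans (sym (U-+ r _ _)) (U-cong r (solve 3 (λ f g i → f :* i :+ g :* i := (f :+ g) :* i) refl f g (φ⁻¹ ^ 18))))
        (∣ˢ-+ (U-ℤ[T]*φ⁻¹⁸ {c} {r} r<3 h₁ h₂ x) (U-ℤ[T]*φ⁻¹⁸ {c} {r} r<3 h₁ h₂ y))
    U-ℤ[T]*φ⁻¹⁸ {c} {r} r<3 h₁ h₂ (scale k {f} x) =
      ∣ˢ-resp (trans (sym (U-#* r k _)) (U-cong r (sym (*-assoc (# k) f _)))) (∣ˢ-* (# k) (U-ℤ[T]*φ⁻¹⁸ {c} {r} r<3 h₁ h₂ x))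
    U-ℤ[T]*φ⁻¹⁸ {c} {r} r<3 h₁ h₂ (resp e x) = ∣ˢ-resp (U-cong r (*-congʳ e)) (U-ℤ[T]*φ⁻¹⁸ {c} {r} r<3 h₁ h₂ x)

  -- The constant term of the polynomial in `T` sets the bound: multiples of `T` give 9 · 3 here and
  -- 9 · 3² in `U2-Y`, each one factor 3 more than is claimed.
  U1-Y : ∀ {p} → ℤ[T] p → # (+ 9) ∣ˢ U 1 (Y * p)
  U1-Y {p} x = ∣ˢ-resp (sym (trans (U-cong 1 (Y*-V p)) (U-V* _ _ 1<3)))
    (∣ˢ-* ((φ ^ 3) ^ 4) (U-ℤ[T]*φ⁻¹⁸ 1<3 U1-φ⁻¹⁸ (# (+ 3) ^ 1 , refl) x))

  U2-Y : ∀ {p} → ℤ[T] p → # (+ 27) ∣ˢ U 2 (Y * p)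
  U2-Y {p} x = ∣ˢ-resp (sym (trans (U-cong 2 (Y*-V p)) (U-V* _ _ 2<3)))
    (∣ˢ-* ((φ ^ 3) ^ 4) (U-ℤ[T]*φ⁻¹⁸ 2<3 U2-φ⁻¹⁸
      (# (+ 3) , solve 0 (con (+ 9) :* con (+ 3) :^ 2 := con (+ 27) :* con (+ 3)) refl) x))

  U2-D : U 2 D ≈ # (+ 9) * B ^ 2
  U2-D = begin
    U 2 (a ^ 2 + a * s + s ^ 2)
      ≈⟨ U-cong 2 (+-cong (+-cong (sym (V-^ A 2)) (solve 2 (λ a s → a :* s := s :^ 1 :* a) refl a s))
           (trans (sym (*-identityʳ _)) (*-congˡ (sym (V-# 1ℤ))))) ⟩
    U 2 (V (A ^ 2) + s ^ 1 * V A + s ^ 2 * V (# 1ℤ))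
      ≈⟨ trans (U-+ 2 _ _) (+-cong (trans (U-+ 2 _ _) (+-cong (U2-V _) (U-s^-off 0 _ 2<3 1<3 λ ()))) (U-s^-diag 2 0 _)) ⟩
    # 0ℤ + # 0ℤ + # 1ℤ * (# (+ 3) * B) ^ 2 * # 1ℤ
      ≈⟨ solve 1 (λ b → con 0ℤ :+ con 0ℤ :+ con 1ℤ :* (con (+ 3) :* b) :^ 2 :* con 1ℤ := con (+ 9) :* b :^ 2) refl B ⟩
    # (+ 9) * B ^ 2 ∎

  P : ℤ⟦q⟧
  P = φ⁻¹ ^ 3 * V (V (φ⁻¹ ^ 3))

  -- Only s² in `D` has exponents ≡ 2 mod 3, giving 9B². The section sends q⁹ to q³, so the second
  -- infinite product of `P` becomes `V (φ⁻¹ ^ 3)` and cancels one of the three factors `B`.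
  U2-P : U 2 P ≈ # (+ 9) * X
  U2-P = begin
    U 2 (φ⁻¹ ^ 3 * V (V i))
      ≈⟨ U-cong 2 (trans (*-congʳ φ⁻³) (solve 3 (λ d m v → d :* m :* v := m :* v :* d) refl D (V M) (V (V i)))) ⟩
    U 2 (V M * V (V i) * D)
      ≈⟨ trans (U-cong 2 (*-congʳ (sym (V-* M (V i))))) (trans (U-V* _ D 2<3) (*-congˡ U2-D)) ⟩
    φ⁻¹ ^ 12 * B * V i * (# (+ 9) * B ^ 2)
      ≈⟨ solve 3 (λ j b v → j :* b :* v :* (con (+ 9) :* b :^ 2) := con (+ 9) :* (b :^ 2 :* j) :* (v :* b)) refl (φ⁻¹ ^ 12) B (V i) ⟩
    # (+ 9) * X * (V i * B)
      ≈⟨ trans (*-congˡ (trans (sym (V-* i (φ ^ 3))) (trans (V-cong (φ⁻¹^*φ^≈1 3)) (V-# 1ℤ)))) (*-identityʳ _) ⟩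
    # (+ 9) * X ∎
    where i = φ⁻¹ ^ 3

-- The counting function as coefficients of `P`.

module Partitions where

  open import Data.Integer.Base as ℤ using (+_; 1ℤ)
  import Data.Integer.Properties as ℤ
  open import Data.Nat.Base as ℕ using (ℕ; zero; suc; _∸_)
  import Data.Nat.Properties as ℕ
  open import Relation.Binary.PropositionalEquality as ≡ using (_≡_)
  import Relation.Binary.Reasoning.Setoid as ≈-Reasoning
  open import Defs
  open Convolution
  open PowerSeries
  open Dissection
  open EulerProduct
  open CubicNorm using (V-1-q^)
  open Sections using (P)

  toℤ⟦q⟧ : Series → ℤ⟦q⟧
  toℤ⟦q⟧ f = series λ n → + f n

  -- `sumTo` splits off its last term but `_⋆_` its first; this reconciles the two recursions.
  sumTo-suc : ∀ n f → sumTo (suc n) f ≡ f 0 ℕ.+ sumTo n (λ i → f (suc i))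
  sumTo-suc zero    f = ≡.refl
  sumTo-suc (suc n) f = ≡.trans (≡.cong (ℕ._+ f (2 ℕ.+ n)) (sumTo-suc n f)) (ℕ.+-assoc (f 0) _ _)

  ⊛-⋆ : ∀ f g n → + (f ⊛ g) n ≡ ((λ i → + f i) ⋆ (λ i → + g i)) n
  ⊛-⋆ f g zero    = ℤ.pos-* (f 0) (g 0)
  ⊛-⋆ f g (suc n) = ≡.trans
    (≡.cong +_ (sumTo-suc n (λ i → f i ℕ.* g (suc n ∸ i))))
    (≡.trans (ℤ.pos-+ (f 0 ℕ.* g (suc n)) _) (≡.cong₂ ℤ._+_ (ℤ.pos-* (f 0) (g (suc n))) (⊛-⋆ (λ i → f (suc i)) g n)))

  toℤ⟦q⟧-⊛ : ∀ f g → toℤ⟦q⟧ (f ⊛ g) ≈ toℤ⟦q⟧ f * toℤ⟦q⟧ g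
  toℤ⟦q⟧-⊛ f g = coeffwise λ n → ≡.trans (⊛-⋆ f g n) (≡.sym (coeff-* (toℤ⟦q⟧ f) (toℤ⟦q⟧ g) n))

  toℤ⟦q⟧-one : toℤ⟦q⟧ one ≈ # 1ℤ
  toℤ⟦q⟧-one = coeffwise λ { zero → ≡.sym (coeff-# 1ℤ 0) ; (suc n) → ≡.sym (coeff-# 1ℤ (suc n)) }

  -- Both sides are inverses of 1 - q^(9(k+1)), and inverses are unique; this avoids comparing
  -- divisibility by 9(k+1) coefficient by coefficient.
  geometric-dilate : ∀ k → geometric (9 ℕ.* suc k) ≈ V (V (geometric (suc k)))
  geometric-dilate k = begin
    g                ≈⟨ *-identityʳ g ⟨
    g * # 1ℤ         ≈⟨ *-congˡ VVg*y≈1 ⟨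
    g * (VVg * y)    ≈⟨ solve 3 (λ g h y → g :* (h :* y) := g :* y :* h) refl g VVg y ⟩
    -- `9 * suc k` reduces to the successor of `k + 8 * suc k`, the index that `geometric-inverse`
    -- expects.
    g * y * VVg      ≈⟨ *-congʳ (geometric-inverse (k ℕ.+ 8 ℕ.* suc k)) ⟩
    # 1ℤ * VVg       ≈⟨ *-identityˡ VVg ⟩
    VVg              ∎
    where
    open ≈-Reasoning setoid
    g = geometric (9 ℕ.* suc k)
    y = # 1ℤ - q ^ (9 ℕ.* suc k)
    VVg = V (V (geometric (suc k)))
    VVg*y≈1 : VVg * y ≈ # 1ℤ
    VVg*y≈1 = begin
      VVg * y
        ≈⟨ *-congˡ (+-congˡ (-‿cong (reflexive (≡.cong (q ^_) (≡.trans (ℕ.*-comm 9 (suc k)) (≡.sym (ℕ.*-assoc (suc k) 3 3))))))) ⟩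
      VVg * (# 1ℤ - q ^ (suc k ℕ.* 3 ℕ.* 3))
        ≈⟨ *-congˡ (trans (sym (V-1-q^ (suc k ℕ.* 3))) (V-cong (sym (V-1-q^ (suc k))))) ⟩
      VVg * V (V (# 1ℤ - q ^ suc k))
        ≈⟨ trans (sym (V-* _ _)) (V-cong (trans (sym (V-* _ _)) (V-cong (geometric-inverse k)))) ⟩
      V (V (# 1ℤ))
        ≈⟨ trans (V-cong (V-# 1ℤ)) (V-# 1ℤ) ⟩
      # 1ℤ ∎

  toℤ⟦q⟧-factor : ∀ k → let g = geometric (suc k) in toℤ⟦q⟧ (factor (suc k)) ≈ g ^ 3 * V (V (g ^ 3))
  toℤ⟦q⟧-factor k = begin
    toℤ⟦q⟧ (factor (suc k))
      ≈⟨ trans (toℤ⟦q⟧-⊛ _ _) (*-congˡ (trans (toℤ⟦q⟧-⊛ _ _) (*-congˡ (trans (toℤ⟦q⟧-⊛ _ _) (*-congˡ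
           (trans (toℤ⟦q⟧-⊛ _ _) (*-cong (geometric-dilate k) (trans (toℤ⟦q⟧-⊛ _ _) (*-cong (geometric-dilate k) (geometric-dilate k)))))))))) ⟩
    g * (g * (g * (v * (v * v))))
      ≈⟨ solve 2 (λ g v → g :* (g :* (g :* (v :* (v :* v)))) := g :^ 3 :* v :^ 3) refl g v ⟩
    g ^ 3 * v ^ 3
      ≈⟨ *-congˡ (trans (V-cong (V-^ g 3)) (V-^ (V g) 3)) ⟨
    g ^ 3 * V (V (g ^ 3)) ∎
    where
    open ≈-Reasoning setoid
    g = geometric (suc k)
    v = V (V g)

  toℤ⟦q⟧-partialProd : ∀ n → toℤ⟦q⟧ (partialProd n) ≈ poch⁻¹ n ^ 3 * V (V (poch⁻¹ n ^ 3))
  toℤ⟦q⟧-partialProd zero = begin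
    toℤ⟦q⟧ one                          ≈⟨ toℤ⟦q⟧-one ⟩
    # 1ℤ                               ≈⟨ *-identityˡ _ ⟨
    # 1ℤ * # 1ℤ                        ≈⟨ *-cong 1≈1^3 (sym (trans (V-cong (V-cong (sym 1≈1^3))) (trans (V-cong (V-# 1ℤ)) (V-# 1ℤ)))) ⟩
    # 1ℤ ^ 3 * V (V (# 1ℤ ^ 3))        ∎
    where
    open ≈-Reasoning setoid
    1≈1^3 : # 1ℤ ≈ # 1ℤ ^ 3
    1≈1^3 = solve 0 (con 1ℤ := con 1ℤ :^ 3) refl
  toℤ⟦q⟧-partialProd (suc n) = begin
    toℤ⟦q⟧ (partialProd n ⊛ factor (suc n))
      ≈⟨ trans (toℤ⟦q⟧-⊛ _ _) (*-cong (toℤ⟦q⟧-partialProd n) (toℤ⟦q⟧-factor n)) ⟩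
    p ^ 3 * V (V (p ^ 3)) * (g ^ 3 * V (V (g ^ 3)))
      ≈⟨ solve 4 (λ p v g w → p :* v :* (g :* w) := p :* g :* (v :* w)) refl (p ^ 3) (V (V (p ^ 3))) (g ^ 3) (V (V (g ^ 3))) ⟩
    p ^ 3 * g ^ 3 * (V (V (p ^ 3)) * V (V (g ^ 3)))
      ≈⟨ *-congˡ (trans (V-cong (V-* _ _)) (V-* _ _)) ⟨
    p ^ 3 * g ^ 3 * V (V (p ^ 3 * g ^ 3))
      ≈⟨ *-cong (^-distrib-* p g 3) (V-cong (V-cong (^-distrib-* p g 3))) ⟨
    poch⁻¹ (suc n) ^ 3 * V (V (poch⁻¹ (suc n) ^ 3)) ∎
    where
    open ≈-Reasoning setoid
    p = poch⁻¹ n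
    g = geometric (suc n)

  p93-coeff : ∀ n → coeff P n ≡ + p93 n
  p93-coeff n = at≤ (≤trans (*-cong≤ φ⁻³≤ (V-cong≤ (V-cong≤ φ⁻³≤))) (≈⇒upto (sym (toℤ⟦q⟧-partialProd n)))) n ℕ.≤-refl
    where
    φ⁻³≤ : φ⁻¹ ^ 3 ≈ poch⁻¹ n ^ 3 upto n
    φ⁻³≤ = ^-cong≤ 3 (φ⁻¹-upto ℕ.≤-refl)

-- Iterating the sections and reading off divisibility.

module Congruences where

  open import Data.Integer.Base as ℤ using (+_; ∣_∣; 1ℤ)
  import Data.Integer.Properties as ℤ
  open import Data.Nat.Base using (ℕ; zero; suc; _+_; _*_; _^_)
  import Data.Nat.Properties as ℕ
  open import Data.Nat.Divisibility using (_∣_; divides)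
  open import Data.Nat.Solver using (module +-*-Solver)
  open import Data.Product using (∃-syntax; _×_; _,_)
  open import Relation.Binary.PropositionalEquality using (_≡_; refl; sym; trans; cong; module ≡-Reasoning)
  open import Defs using (p93)
  module S = PowerSeries
  open S using (ℤ⟦q⟧; coeff; #; _≈_; at)
  open Dissection using (U; U-cong; U-#*)
  open Forms using (ℤ[T]; one; X; Y; _∣ˢ_)
  open Sections using (P; U2-P; U1-X; U2-X; U0-Y; U1-Y; U2-Y)
  open Partitions using (p93-coeff)

  -- The offset (3^(2α-1) + 5)/4 without division, for α = a + 1. Replacing n by 2 + 9n in the
  -- progression 3 · 9^a n + δ raises the offset by 6 · 9^a.
  δ : ℕ → ℕ
  δ zero    = 2
  δ (suc a) = δ a + 6 * 9 ^ a

  -- The generating functions of p93 along 3^(2α−1) n + δ and, for the even ones, along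
  -- 3^(2α) n + δ + 2 · 3^(2α−1), where α = a + 1.
  L-odd L-even : ℕ → ℤ⟦q⟧
  L-odd zero    = U 2 P
  L-odd (suc a) = U 0 (L-even a)
  L-even a = U 2 (L-odd a)

  coeff-L-odd : ∀ a n → coeff (L-odd a) n ≡ + p93 (3 * 9 ^ a * n + δ a)
  coeff-L-odd zero    n = trans (p93-coeff (2 + n * 3)) (cong (λ m → + p93 m)
    (let open +-*-Solver in solve 1 (λ n → con 2 :+ n :* con 3 := con 3 :* n :+ con 2) refl n))
  -- `U 0` after `U 2` reads the coefficient at 2 + 9n.
  coeff-L-odd (suc a) n = trans (coeff-L-odd a (2 + n * 3 * 3)) (cong (λ m → + p93 m)
    (let open +-*-Solver in solve 3 (λ w n d → con 3 :* w :* (con 2 :+ n :* con 3 :* con 3) :+ d :=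
       con 3 :* (con 9 :* w) :* n :+ (d :+ con 6 :* w)) refl (9 ^ a) n (δ a)))

  private
    9^ : ℕ → ℤ⟦q⟧
    9^ n = # (+ (9 ^ n))

    9^-suc : ∀ n f → 9^ n S.* (# (+ 9) S.* f) ≈ 9^ (suc n) S.* f
    9^-suc n f = S.trans (S.sym (S.*-assoc _ _ f)) (S.*-congʳ (S.trans (S.sym (S.#-* _ _))
      (S.reflexive (cong # (trans (sym (ℤ.pos-* (9 ^ n) 9)) (cong +_ (ℕ.*-comm (9 ^ n) 9)))))))

    L-even-from : ∀ a {p} → ℤ[T] p → L-odd a ≈ 9^ (suc a) S.* (X S.* p) →
                  ∃[ p′ ] ℤ[T] p′ × L-even a ≈ 9^ (2 + a) S.* (Y S.* p′)
    L-even-from a x eq =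
      let p′ , x′ , eq′ = U2-X x
      in p′ , x′ , S.trans (U-cong 2 eq) (S.trans (U-#* 2 _ _) (S.trans (S.*-congˡ eq′) (9^-suc (suc a) _)))

  L-odd-form : ∀ a → ∃[ p ] ℤ[T] p × L-odd a ≈ 9^ (suc a) S.* (X S.* p)
  L-odd-form zero    = # 1ℤ , one , S.trans U2-P (S.*-congˡ (S.sym (S.*-identityʳ X)))
  L-odd-form (suc a) =
    let p , x , eq = L-odd-form a
        p′ , x′ , eq′ = L-even-from a x eq
        p″ , x″ , eq″ = U0-Y x′
    in p″ , x″ , S.trans (U-cong 0 eq′) (S.trans (U-#* 0 _ _) (S.*-congˡ eq″))

  L-even-form : ∀ a → ∃[ p ] ℤ[T] p × L-even a ≈ 9^ (2 + a) S.* (Y S.* p)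
  L-even-form a = let p , x , eq = L-odd-form a in L-even-from a x eq

  private
    coeff-divisible : ∀ {m f} → # (+ m) ∣ˢ f → ∀ n {k} → coeff f n ≡ + k → m ∣ k
    coeff-divisible {m} {f} (h , eq) n {k} f≡k = divides ∣ coeff h n ∣ (begin
      k                          ≡⟨ cong ∣_∣ f≡k ⟨
      ∣ coeff f n ∣              ≡⟨ cong ∣_∣ (trans (at eq n) (S.coeff-#* (+ m) h n)) ⟩
      ∣ + m ℤ.* coeff h n ∣      ≡⟨ ℤ.abs-* (+ m) (coeff h n) ⟩
      m * ∣ coeff h n ∣          ≡⟨ ℕ.*-comm m _ ⟩
      ∣ coeff h n ∣ * m          ∎)
      where open ≡-Reasoning

    ∣ˢ-section : ∀ r {m c f g} → f ≈ # (+ m) S.* g → # (+ c) ∣ˢ U r g → # (+ (m * c)) ∣ˢ U r f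
    ∣ˢ-section r {m} {c} eq (h , eq′) = h , S.trans (U-cong r eq) (S.trans (U-#* r _ _) (S.trans (S.*-congˡ eq′)
      (S.trans (S.sym (S.*-assoc _ _ h)) (S.*-congʳ (S.trans (S.sym (S.#-* _ _)) (S.reflexive (cong # (sym (ℤ.pos-* m c)))))))))

  module _ (a n : ℕ) where
    private
      w = 3 * 9 ^ a

    p93-odd : 9 ^ suc a ∣ p93 (w * n + δ a)
    p93-odd = let p , x , eq = L-odd-form a in coeff-divisible (_ , eq) n (coeff-L-odd a n)

    p93-odd-1 : 9 ^ suc a * 3 ∣ p93 (w * (1 + n * 3) + δ a)
    p93-odd-1 = let p , x , eq = L-odd-form a in
      coeff-divisible (∣ˢ-section 1 eq (U1-X x)) n (coeff-L-odd a (1 + n * 3))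

    p93-odd-2 : 9 ^ suc a * 9 ∣ p93 (w * (2 + n * 3) + δ a)
    p93-odd-2 = let p , x , eq = L-odd-form a ; p′ , x′ , eq′ = U2-X x in
      coeff-divisible (∣ˢ-section 2 eq (_ , eq′)) n (coeff-L-odd a (2 + n * 3))

    -- The nested index reads from outside in: `U 2` was applied to `L-odd a` first, then `U 1` to
    -- the result.
    p93-even-1 : 9 ^ (2 + a) * 9 ∣ p93 (w * (2 + (1 + n * 3) * 3) + δ a)
    p93-even-1 = let p , x , eq = L-even-form a in
      coeff-divisible (∣ˢ-section 1 eq (U1-Y x)) n (coeff-L-odd a (2 + (1 + n * 3) * 3))

    p93-even-2 : 9 ^ (2 + a) * 27 ∣ p93 (w * (2 + (2 + n * 3) * 3) + δ a)
    p93-even-2 = let p , x , eq = L-even-form a in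
      coeff-divisible (∣ˢ-section 2 eq (U2-Y x)) n (coeff-L-odd a (2 + (2 + n * 3) * 3))

-- Matching the progressions and moduli with their closed forms.

module Indices where

  open import Data.Nat.Base using (ℕ; zero; suc; _+_; _*_; _∸_; _^_; _/_)
  import Data.Nat.Properties as ℕ
  open import Data.Nat.DivMod using (m*n/n≡m)
  open import Data.Nat.Solver using (module +-*-Solver)
  open import Relation.Binary.PropositionalEquality
  open Congruences using (δ)
  open +-*-Solver

  3^[2α] : ∀ α → 3 ^ (2 * α) ≡ 9 ^ α
  3^[2α] α = sym (ℕ.^-*-assoc 3 2 α)

  3^[2α+k] : ∀ α k → 3 ^ (2 * α + k) ≡ 9 ^ α * 3 ^ k
  3^[2α+k] α k = trans (ℕ.^-distribˡ-+-* 3 (2 * α) k) (cong (_* 3 ^ k) (3^[2α] α))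

  3^[2α∸1] : ∀ a → 3 ^ (2 * suc a ∸ 1) ≡ 3 * 9 ^ a
  3^[2α∸1] a = trans (cong (3 ^_) (ℕ.+-suc a (a + 0))) (cong (3 *_) (3^[2α] a))

  δ*4 : ∀ a → δ a * 4 ≡ 3 * 9 ^ a + 5
  δ*4 zero    = refl
  δ*4 (suc a) = begin
    (δ a + 6 * w) * 4       ≡⟨ ℕ.*-distribʳ-+ 4 (δ a) (6 * w) ⟩
    δ a * 4 + 6 * w * 4     ≡⟨ cong (_+ 6 * w * 4) (δ*4 a) ⟩
    3 * w + 5 + 6 * w * 4   ≡⟨ solve 1 (λ w → con 3 :* w :+ con 5 :+ con 6 :* w :* con 4 := con 3 :* (con 9 :* w) :+ con 5) refl w ⟩
    3 * (9 * w) + 5         ∎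
    where
    open ≡-Reasoning
    w = 9 ^ a

  shift/4 : ∀ a k {m} → m ≡ (3 + 4 * k) * 9 ^ a + 5 → m / 4 ≡ δ a + k * 9 ^ a
  shift/4 a k {m} eq = trans (cong (_/ 4) (trans eq (sym (begin
    (δ a + k * w) * 4       ≡⟨ ℕ.*-distribʳ-+ 4 (δ a) (k * w) ⟩
    δ a * 4 + k * w * 4     ≡⟨ cong (_+ k * w * 4) (δ*4 a) ⟩
    3 * w + 5 + k * w * 4   ≡⟨ solve 2 (λ w k → con 3 :* w :+ con 5 :+ k :* w :* con 4 := (con 3 :+ con 4 :* k) :* w :+ con 5) refl w k ⟩
    (3 + 4 * k) * w + 5     ∎))))
    (m*n/n≡m (δ a + k * w) 4)
    where
    open ≡-Reasoning
    w = 9 ^ a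

  private
    -- All quantities are measured in units of 9^a: a numerator (3 + 4k) 9^a + 5 is exactly four
    -- times δ + k 9^a. The coefficients 3, 63, 99, 15 and 27 of 9^a in the five offsets give k = 0,
    -- 15, 24, 3 and 6.
    index : ∀ a n i c k {x m} → x ≡ c * 9 ^ a → m ≡ (3 + 4 * k) * 9 ^ a + 5 → 3 * i ≡ c * n + k →
            3 * 9 ^ a * i + δ a ≡ x * n + m / 4
    index a n i c k {x} {m} x≡ m≡ 3i≡ = begin
      3 * w * i + δ a             ≡⟨ solve 3 (λ w i d → con 3 :* w :* i :+ d := con 3 :* i :* w :+ d) refl w i (δ a) ⟩
      3 * i * w + δ a             ≡⟨ cong (λ j → j * w + δ a) 3i≡ ⟩
      (c * n + k) * w + δ a       ≡⟨ solve 5 (λ c n k w d → (c :* n :+ k) :* w :+ d := c :* w :* n :+ (d :+ k :* w)) refl c n k w (δ a) ⟩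
      c * w * n + (δ a + k * w)   ≡⟨ cong₂ (λ y z → y * n + z) x≡ (shift/4 a k m≡) ⟨
      x * n + m / 4               ∎
      where
      open ≡-Reasoning
      w = 9 ^ a

    scale-power : ∀ b w k {y} → y ≡ b * w → k * y + 5 ≡ k * b * w + 5
    scale-power b w k y≡ = cong (_+ 5) (trans (cong (k *_) y≡) (sym (ℕ.*-assoc k b w)))

  3^[2α+1] : ∀ a → 3 ^ (2 * suc a + 1) ≡ 27 * 9 ^ a
  3^[2α+1] a = trans (3^[2α+k] (suc a) 1) (trans (ℕ.*-comm (9 * 9 ^ a) 3) (sym (ℕ.*-assoc 3 9 (9 ^ a))))

  index₁ : ∀ a n → 3 * 9 ^ a * n + δ a ≡ 3 ^ (2 * suc a ∸ 1) * n + (3 ^ (2 * suc a ∸ 1) + 5) / 4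
  index₁ a n = index a n n 3 0 (3^[2α∸1] a) (cong (_+ 5) (3^[2α∸1] a)) (sym (ℕ.+-identityʳ (3 * n)))

  index₂ : ∀ a n → 3 * 9 ^ a * (2 + (1 + n * 3) * 3) + δ a ≡ 3 ^ (2 * suc a + 1) * n + (7 * 3 ^ (2 * suc a) + 5) / 4
  index₂ a n = index a n (2 + (1 + n * 3) * 3) 27 15 (3^[2α+1] a) (scale-power 9 (9 ^ a) 7 (3^[2α] (suc a)))
    (solve 1 (λ n → con 3 :* (con 2 :+ (con 1 :+ n :* con 3) :* con 3) := con 27 :* n :+ con 15) refl n)

  index₃ : ∀ a n → 3 * 9 ^ a * (2 + (2 + n * 3) * 3) + δ a ≡ 3 ^ (2 * suc a + 1) * n + (11 * 3 ^ (2 * suc a) + 5) / 4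
  index₃ a n = index a n (2 + (2 + n * 3) * 3) 27 24 (3^[2α+1] a) (scale-power 9 (9 ^ a) 11 (3^[2α] (suc a)))
    (solve 1 (λ n → con 3 :* (con 2 :+ (con 2 :+ n :* con 3) :* con 3) := con 27 :* n :+ con 24) refl n)

  index₄ : ∀ a n → 3 * 9 ^ a * (1 + n * 3) + δ a ≡ 3 ^ (2 * suc a) * n + (5 * 3 ^ (2 * suc a ∸ 1) + 5) / 4
  index₄ a n = index a n (1 + n * 3) 9 3 (3^[2α] (suc a)) (scale-power 3 (9 ^ a) 5 (3^[2α∸1] a))
    (solve 1 (λ n → con 3 :* (con 1 :+ n :* con 3) := con 9 :* n :+ con 3) refl n)

  index₅ : ∀ a n → 3 * 9 ^ a * (2 + n * 3) + δ a ≡ 3 ^ (2 * suc a) * n + (3 ^ (2 * suc a + 1) + 5) / 4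
  index₅ a n = index a n (2 + n * 3) 9 6 (3^[2α] (suc a)) (cong (_+ 5) (3^[2α+1] a))
    (solve 1 (λ n → con 3 :* (con 2 :+ n :* con 3) := con 9 :* n :+ con 6) refl n)

  modulus₂ : ∀ a → 9 ^ (2 + a) * 9 ≡ 3 ^ (2 * suc a + 4)
  modulus₂ a = trans (trans (cong (_* 9) (ℕ.*-comm 9 (9 ^ suc a))) (ℕ.*-assoc (9 ^ suc a) 9 9)) (sym (3^[2α+k] (suc a) 4))

  modulus₃ : ∀ a → 9 ^ (2 + a) * 27 ≡ 3 ^ (2 * suc a + 5)
  modulus₃ a = trans (trans (cong (_* 27) (ℕ.*-comm 9 (9 ^ suc a))) (ℕ.*-assoc (9 ^ suc a) 9 27)) (sym (3^[2α+k] (suc a) 5))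

open import Data.Nat using (ℕ; suc; _+_; _*_; _∸_; _^_; _≤_; _/_; s≤s)
open import Data.Nat.Divisibility using (_∣_)
open import Data.Product using (_×_; _,_)
open import Relation.Binary.PropositionalEquality using (sym; subst₂)
open import Defs
open Congruences
open Indices

theorem1p3 : (n α : ℕ) → 1 ≤ α →
    (3 ^ (2 * α) ∣ p93 (3 ^ (2 * α ∸ 1) * n + (3 ^ (2 * α ∸ 1) + 5) / 4))
    × (3 ^ (2 * α + 4) ∣ p93 (3 ^ (2 * α + 1) * n + (7 * 3 ^ (2 * α) + 5) / 4))
    × (3 ^ (2 * α + 5) ∣ p93 (3 ^ (2 * α + 1) * n + (11 * 3 ^ (2 * α) + 5) / 4))
    × (3 ^ (2 * α + 1) ∣ p93 (3 ^ (2 * α) * n + (5 * 3 ^ (2 * α ∸ 1) + 5) / 4))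
    × (3 ^ (2 * α + 2) ∣ p93 (3 ^ (2 * α) * n + (3 ^ (2 * α + 1) + 5) / 4))
theorem1p3 n (suc a) (s≤s _) =
    subst₂ _∣p93_ (sym (3^[2α] (suc a))) (index₁ a n) (p93-odd a n)
  , subst₂ _∣p93_ (modulus₂ a) (index₂ a n) (p93-even-1 a n)
  , subst₂ _∣p93_ (modulus₃ a) (index₃ a n) (p93-even-2 a n)
  , subst₂ _∣p93_ (sym (3^[2α+k] (suc a) 1)) (index₄ a n) (p93-odd-1 a n)
  , subst₂ _∣p93_ (sym (3^[2α+k] (suc a) 2)) (index₅ a n) (p93-odd-2 a n)
  where
  _∣p93_ : ℕ → ℕ → Set
  d ∣p93 m = d ∣ p93 m
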